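{- There is a deterministic algorithm that, given a simple undirected graph $G=(V,E)$ with $n=|V|$ vertices and $m=|E|$ edges and a terminal set $U\subseteq V$, computes in $O((m+n)\,\alpha(n))$ time a pair $(X,T)$ such that: 1. $X\subseteq V$ is a set with $|X|\le |U|/2$; and 2. $T\subseteq G$ is a forest of maximum degree at most $4$ such that, for every connected component $C$ of $G-X$, some tree $T_C$ of $T$ spans $U\cap V(C)$.
   Context: $\alpha(\cdot)$ denotes the inverse Ackermann function. $G-X$ denotes the induced subgraph $G[V\setminus X]$. The forest $T$ is a subgraph of $G$ (not necessarily containing all vertices of $G$), and it is allowed to contain vertices of $X$. A tree of $T$ is a connected component of $T$; a tree $T_C$ spans a set $S$ of vertices if $S\subseteq V(T_C)$. The same tree of $T$ may serve several components $C$. Running time is in the standard RAM model with graphs given by adjacency lists. -}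

module Defs where

open import Level using (0ℓ)
open import Data.Bool.Base using (if_then_else_)
open import Data.Nat.Base
open import Data.Nat.Properties
open import Data.Nat.DivMod using (_/_; _%_)
open import Data.Fin.Base as Fin using (Fin; toℕ)
import Data.Fin.Properties as Fin
open import Data.Fin.Subset using (Subset; ∁) renaming (_∈_ to _∈ₛ_)
open import Data.Fin.Subset.Properties using () renaming (_∈?_ to _∈ₛ?_)
open import Data.List.Base
open import Data.List.Membership.Propositional using (_∈_)
open import Data.List.Relation.Unary.AllPairs using (AllPairs)
open import Data.List.Relation.Unary.Linked using (Linked)
open import Data.List.Relation.Unary.Unique.Propositional using (Unique)
open import Data.Maybe.Base using (Maybe; just; nothing)
open import Data.Product.Base using (Σ; ∃-syntax; _×_; _,_; proj₁; proj₂; swap)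
open import Data.Sum.Base using (_⊎_; inj₁; inj₂)
open import Data.Unit.Base using (⊤)
import Data.Vec.Base as Vec
open import Function.Base using (_∘_)
open import Function.Bundles using (_⇔_)
open import Relation.Binary.Core using (Rel)
open import Relation.Binary.Definitions using (Decidable; Symmetric; Irreflexive)
open import Relation.Binary.Construct.Closure.ReflexiveTransitive using (Star)
open import Relation.Binary.PropositionalEquality.Core using (_≡_; _≢_; refl; sym; subst)
open import Relation.Nullary.Decidable using (yes; no; does; _×-dec_)
open import Relation.Nullary.Negation using (¬_)

private
  variable
    n : ℕ

------------------------------------------------------------------------
-- Inverse Ackermann function

ack : ℕ → ℕ → ℕ
ack zero    n       = suc n
ack (suc m) zero    = ack m 1
ack (suc m) (suc n) = ack m (ack (suc m) n)

-- The least k ≥ 1 with n ≤ ack k k (see α-spec).  Starting at 1 keeps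
-- α positive, so that it can be used as a factor of a running time.
α : ℕ → ℕ
α n = search n 1
  module Search where
  search : (fuel k : ℕ) → ℕ
  search zero       k = k
  search (suc fuel) k with n ≤? ack k k
  ... | yes _ = k
  ... | no  _ = search fuel (suc k)

n<ack : ∀ m n → n < ack m n
n<ack zero    n       = ≤-refl
n<ack (suc m) zero    = <-trans (s≤s z≤n) (n<ack m 1)
n<ack (suc m) (suc n) = ≤-<-trans (n<ack (suc m) n) (n<ack m (ack (suc m) n))

α-spec : ∀ n → 1 ≤ α n × n ≤ ack (α n) (α n) ×
               (∀ k → 1 ≤ k → n ≤ ack k k → α n ≤ k)
α-spec n = go n 1 ≤-refl (m≤m+n n 1) (λ _ 1≤k _ → 1≤k)
  where
  open Search n
  Spec : ℕ → Set
  Spec a = 1 ≤ a × n ≤ ack a a × (∀ k → 1 ≤ k → n ≤ ack k k → a ≤ k)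

  go : ∀ f k → 1 ≤ k → n ≤ f + k →
       (∀ j → 1 ≤ j → n ≤ ack j j → k ≤ j) → Spec (search f k)
  go zero    k 1≤k n≤k least = 1≤k , ≤-trans n≤k (<⇒≤ (n<ack k k)) , least
  go (suc f) k 1≤k n≤ least with n ≤? ack k k
  ... | yes p = 1≤k , p , least
  ... | no ¬p = go f (suc k) (s≤s z≤n) (subst (n ≤_) (sym (+-suc f k)) n≤)
    λ j 1≤j q → ≤∧≢⇒< (least j 1≤j q) λ { refl → ¬p q }

------------------------------------------------------------------------
-- Graphs

-- A finite simple undirected graph with vertex set Fin n.
record Graph (n : ℕ) : Set₁ where
  field
    Adj    : Rel (Fin n) 0ℓ
    adj?   : Decidable Adj
    symm   : Symmetric Adj
    irrefl : Irreflexive _≡_ Adj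

  edgeCount : ℕ
  edgeCount = length (filter (λ e → (proj₁ e Fin.<? proj₂ e) ×-dec adj? (proj₁ e) (proj₂ e))
                             (cartesianProduct (allFin n) (allFin n)))

record Subgraph (G : Graph n) : Set₁ where
  field
    V     : Subset n
    Adj   : Rel (Fin n) 0ℓ
    adj?  : Decidable Adj
    symm  : Symmetric Adj
    Adj⇒V : ∀ {u v} → Adj u v → u ∈ₛ V
    Adj⇒G : ∀ {u v} → Adj u v → Graph.Adj G u v

  degree : Fin n → ℕ
  degree v = length (filter (adj? v) (allFin n))

infixl 6 _-_

-- The subgraph induced by the complement of X.
_-_ : (G : Graph n) → Subset n → Subgraph G
G - X = record
  { V     = ∁ X
  ; Adj   = λ u v → Graph.Adj G u v × u ∈ₛ ∁ X × v ∈ₛ ∁ X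
  ; adj?  = λ u v → Graph.adj? G u v ×-dec (u ∈ₛ? ∁ X ×-dec v ∈ₛ? ∁ X)
  ; symm  = λ (e , p , q) → Graph.symm G e , q , p
  ; Adj⇒V = λ (_ , p , _) → p
  ; Adj⇒G = proj₁
  }

module _ {G : Graph n} (H : Subgraph G) where
  open Subgraph H

  -- C is the vertex set of a connected component of H.
  IsComponent : Subset n → Set
  IsComponent C = ∃[ r ] r ∈ₛ V × (∀ v → v ∈ₛ C ⇔ Star Adj r v)

  -- The cycle visits v, then the vertices of vs in order, then v again.
  IsCycle : Fin n → List (Fin n) → Set
  IsCycle v vs = 2 ≤ length vs × Unique (v ∷ vs) × Linked Adj (v ∷ vs ∷ʳ v)

  IsForest : Set
  IsForest = ∀ v vs → ¬ IsCycle v vs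

  -- An edge list of H: every edge occurs exactly once, in one of its two
  -- orientations.
  record IsEdgeList (es : List (Fin n × Fin n)) : Set where
    field
      listed : ∀ u v → Adj u v ⇔ ((u , v) ∈ es ⊎ (v , u) ∈ es)
      once   : AllPairs (λ e f → e ≢ f × e ≢ swap f) es

-- Adjacency lists of G; the order within each list is arbitrary.
record AdjacencyLists (G : Graph n) : Set where
  field
    nbrs   : Fin n → List (Fin n)
    listed : ∀ u v → v ∈ nbrs u ⇔ Graph.Adj G u v
    once   : ∀ u → Unique (nbrs u)

------------------------------------------------------------------------
-- Word RAM

-- Operands are register numbers, except for the literal of const.  Jump
-- targets are absolute positions in the program.
data Instr : Set where
  const               : (d c : ℕ) → Instr          -- rd ← c
  add sub mul div     : (d a b : ℕ) → Instr        -- rd ← ra ∘ rb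
  load                : (d a : ℕ) → Instr          -- rd ← mem[ra]
  store               : (a s : ℕ) → Instr          -- mem[ra] ← rs
  jump                : (l : ℕ) → Instr
  jump-if-< jump-if-≡ : (a b l : ℕ) → Instr        -- compares ra with rb
  halt                : Instr

Program : Set
Program = List Instr

record State : Set where
  constructor ⟨_,_,_⟩
  field
    pc  : ℕ
    reg : ℕ → ℕ
    mem : ℕ → ℕ

open State public

infixl 9 _[_≔_]

_[_≔_] : (ℕ → ℕ) → ℕ → ℕ → (ℕ → ℕ)
(f [ i ≔ x ]) j = if does (i ≟ j) then x else f j

quot : ℕ → ℕ → ℕ
quot x zero      = 0
quot x y@(suc _) = x / y

-- Everything written to a register is reduced to `bits` bits, so a machine
-- of that word length addresses the memory cells 0, …, 2 ^ bits - 1 only.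
module _ (bits : ℕ) where

  toWord : ℕ → ℕ
  toWord x = _%_ x (2 ^ bits) {{m^n≢0 2 bits}}

  exec : Instr → State → Maybe State
  exec (const d c)       ⟨ p , r , m ⟩ = just ⟨ suc p , r [ d ≔ toWord c ] , m ⟩
  exec (add d a b)       ⟨ p , r , m ⟩ = just ⟨ suc p , r [ d ≔ toWord (r a + r b) ] , m ⟩
  exec (sub d a b)       ⟨ p , r , m ⟩ = just ⟨ suc p , r [ d ≔ toWord (r a ∸ r b) ] , m ⟩
  exec (mul d a b)       ⟨ p , r , m ⟩ = just ⟨ suc p , r [ d ≔ toWord (r a * r b) ] , m ⟩
  exec (div d a b)       ⟨ p , r , m ⟩ = just ⟨ suc p , r [ d ≔ toWord (quot (r a) (r b)) ] , m ⟩
  exec (load d a)        ⟨ p , r , m ⟩ = just ⟨ suc p , r [ d ≔ toWord (m (r a)) ] , m ⟩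
  exec (store a s)       ⟨ p , r , m ⟩ = just ⟨ suc p , r , m [ r a ≔ r s ] ⟩
  exec (jump l)          ⟨ p , r , m ⟩ = just ⟨ l , r , m ⟩
  exec (jump-if-< a b l) ⟨ p , r , m ⟩ =
    just ⟨ (if does (r a <? r b) then l else suc p) , r , m ⟩
  exec (jump-if-≡ a b l) ⟨ p , r , m ⟩ =
    just ⟨ (if does (r a ≟ r b) then l else suc p) , r , m ⟩
  exec halt              s             = nothing

  -- nothing: the machine has halted, by halt or by leaving the program.
  step : Program → State → Maybe State
  step P s with head (drop (pc s) P)
  ... | just i  = exec i s
  ... | nothing = nothing

  -- Run P t s s′: started in s, P halts in s′ after exactly t steps.
  data Run (P : Program) : ℕ → State → State → Set where
    stop : ∀ {s} → step P s ≡ nothing → Run P 0 s s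
    next : ∀ {t s s′ s″} → step P s ≡ just s′ → Run P t s′ s″ → Run P (suc t) s s″

contents : List ℕ → ℕ → ℕ
contents []       _       = 0
contents (x ∷ _)  zero    = x
contents (_ ∷ xs) (suc i) = contents xs i

-- The input occupies the cells from 0 on; all else is 0.
initial : List ℕ → State
initial xs = ⟨ 0 , (λ _ → 0) , contents xs ⟩

StoredAt : (ℕ → ℕ) → ℕ → List ℕ → Set
StoredAt m a []       = ⊤
StoredAt m a (x ∷ xs) = m a ≡ x × StoredAt m (suc a) xs

-- The output is found in memory at the address held by register 0.
Outputs : (bits : ℕ) → State → List ℕ → Set
Outputs bits s ys = reg s 0 + length ys ≤ 2 ^ bits × StoredAt (mem s) (reg s 0) ys

------------------------------------------------------------------------
-- Input and output encodings

bitVector : Subset n → List ℕ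
bitVector S = Vec.toList (Vec.map (λ b → if b then 1 else 0) S)

-- Consecutive blocks, each preceded by its length.
blocks : List (List (Fin n)) → List ℕ
blocks = concatMap (λ l → length l ∷ map toℕ l)

-- The addresses of those blocks when the first one is put at address a.
blockAddresses : ℕ → List (List (Fin n)) → List ℕ
blockAddresses a []       = []
blockAddresses a (l ∷ ls) = a ∷ blockAddresses (a + suc (length l)) ls

-- The number of vertices, a table of pointers to the adjacency lists, the
-- adjacency lists, and the characteristic vector of the terminal set.
encodeInput : {G : Graph n} → AdjacencyLists G → Subset n → List ℕ
encodeInput {n} L U = n ∷ blockAddresses (suc n) ls ++ blocks ls ++ bitVector U
  where
  ls : List (List (Fin n))
  ls = tabulate (AdjacencyLists.nbrs L)

-- X, the vertex set of T, and the edges of T preceded by their number.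
encodeOutput : Subset n → Subset n → List (Fin n × Fin n) → List ℕ
encodeOutput X VT es = bitVector X ++ bitVector VT ++
  length es ∷ concatMap (λ (u , v) → toℕ u ∷ toℕ v ∷ []) es

-- Within t steps P outputs, on the input (G , U), the pair (X , T).  The
-- word length k + w exceeds by at most a constant k the number w of bits
-- used to address the input.
Computes : Program → (k w : ℕ) {G : Graph n} → AdjacencyLists G → Subset n →
           (time : ℕ) → Subset n → Subgraph G → Set
Computes P k w L U time X T =
  ∃[ t ] ∃[ s ] ∃[ es ]
    t ≤ time × Run (k + w) P t (initial (encodeInput L U)) s ×
    IsEdgeList T es × Outputs (k + w) s (encodeOutput X (Subgraph.V T) es)

module Submission where

-- Depth-first search, started from every vertex that is still unvisited, with
-- one change: a vertex is popped as soon as it is saturated, i.e. has a count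
-- of 3, where the count of v is the number of children linked to v, plus one
-- if v is a terminal.  A popped vertex with a positive count is linked to its
-- parent.  X is the set of saturated vertices and T the set of links, so that
-- a vertex has at most three children in T and one parent.  A vertex outside
-- X has scanned all its neighbours, each of which then had been visited from
-- the same root or an earlier one; by symmetry the ends of an edge of G - X
-- share their root, and every terminal is linked to its root.  Every terminal
-- provides one token, a vertex in X consumes two, and a link passes one on,
-- whence 2|X| ≤ |U|.  This takes linear time: no union-find is needed.

open import Defs
open import Level using (0ℓ)
open import Data.Nat.Base using (ℕ; suc; _+_; _*_; _^_; _≤_)
open import Data.Fin.Subset using (Subset; _⊆_; _∩_; ∣_∣)
open import Data.List.Base using (length)
open import Data.Product.Base using (Σ; ∃-syntax; _×_)
open import Data.Bool.Base using (true; false; if_then_else_)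
open import Data.Nat.Base using (zero; _∸_; _<_; z≤n; s≤s; s≤s⁻¹)
open import Data.Nat.Properties as Nat hiding (_≟_)
open import Data.Nat.DivMod using (_/_; m<n⇒m%n≡m; m/n*n≤m; m/n≤m)
open import Data.Nat.Tactic.RingSolver using (solve-∀)
open import Data.Fin.Base as Fin using (Fin; zero; suc; toℕ; fromℕ<)
open import Data.Fin.Properties as Fin using (_≟_; toℕ<n; toℕ-injective; toℕ-fromℕ<)
open import Data.Fin.Subset using (⊤; ∁) renaming (_∈_ to _∈ₛ_)
open import Data.Fin.Subset.Properties using (∈⊤; x∈∁p⇒x∉p; x∈p∩q⁻)
open import Data.List.Base using (List; []; _∷_; _++_; _∷ʳ_; map; filter; concat; concatMap; tabulate; allFin; cartesianProduct; lookup; head; drop)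
open import Data.List.Properties using (length-++; length-map; length-tabulate; concatMap-++; filter-++; filter-accept; filter-reject; ++-identityʳ)
open import Data.List.Membership.Propositional using (_∈_; _∉_)
open import Data.List.Membership.Propositional.Properties
open import Data.List.Relation.Unary.All as All using (All; []; _∷_)
import Data.List.Relation.Unary.All.Properties as All
open import Data.List.Relation.Unary.Any as Any using (here; there)
import Data.List.Relation.Unary.Any.Properties as Any
open import Data.List.Relation.Unary.AllPairs as AllPairs using (AllPairs; []; _∷_)
import Data.List.Relation.Unary.AllPairs.Properties as AllPairs
open import Data.List.Relation.Unary.Linked using (Linked; []; [-]; _∷_)
open import Data.List.Relation.Unary.Unique.Propositional using (Unique)
import Data.List.Relation.Unary.Unique.Propositional.Properties as Unique
open import Data.Maybe.Base using (Maybe; just; nothing)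
open import Data.Product.Base using (_,_; proj₁; proj₂; swap; ∃; ∃₂; map₁; map₂)
open import Data.Product.Properties using (≡-dec)
open import Data.Sum.Base as Sum using (_⊎_; inj₁; inj₂)
open import Data.Unit.Base using (tt) renaming (⊤ to Unit)
import Data.Vec.Base as Vec
import Data.Vec.Properties as Vec
open import Algebra.Properties.Monoid.Sum +-0-monoid using () renaming (sum to ∑)
open import Function.Base using (_∘_; id)
open import Function.Bundles using (_⇔_; mk⇔; Equivalence)
open import Relation.Binary.Core using (Rel)
open import Relation.Binary.Definitions using (Decidable; Symmetric; tri<; tri≈; tri>)
open import Relation.Binary.Construct.Closure.ReflexiveTransitive as Star using (Star; ε; _◅_; _◅◅_)
open import Relation.Binary.PropositionalEquality
  using (_≡_; _≢_; _≗_; refl; sym; trans; cong; cong₂; subst; module ≡-Reasoning)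
open import Relation.Nullary.Decidable using (Dec; yes; no; does; _×-dec_; _⊎-dec_; map′; dec-true; dec-false)
open import Relation.Nullary.Negation using (¬_; contradiction)

private
  variable
    A : Set
    n : ℕ

Unique-⊆⇒length-≤ : {xs ys : List A} → Unique xs → (∀ {x} → x ∈ xs → x ∈ ys) →
                    length xs ≤ length ys
Unique-⊆⇒length-≤ {xs = []}     _        _   = z≤n
Unique-⊆⇒length-≤ {xs = x ∷ xs} (x∉ ∷ u) incl with ∈-∃++ (incl (here refl))
... | as , bs , refl = begin
  suc (length xs)               ≤⟨ s≤s (Unique-⊆⇒length-≤ u incl′) ⟩
  suc (length (as ++ bs))       ≡⟨ cong suc (length-++ as) ⟩
  suc (length as + length bs)   ≡⟨ +-suc (length as) (length bs) ⟨
  length as + suc (length bs)   ≡⟨ length-++ as ⟨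
  length (as ++ x ∷ bs)         ∎
  where
  open ≤-Reasoning
  incl′ : ∀ {y} → y ∈ xs → y ∈ as ++ bs
  incl′ y∈ with ∈-++⁻ as (incl (there y∈))
  ... | inj₁ y∈as          = ∈-++⁺ˡ y∈as
  ... | inj₂ (here refl)   = contradiction refl (All.lookup x∉ y∈)
  ... | inj₂ (there y∈bs)  = ∈-++⁺ʳ as y∈bs

Unique⇒length-≤ : {xs : List (Fin n)} → Unique xs → length xs ≤ n
Unique⇒length-≤ {n} {xs} u =
  subst (length xs ≤_) (length-tabulate id) (Unique-⊆⇒length-≤ u λ _ → ∈-allFin _)

-- Point updates and sums of functions on Fin n

infixl 9 _⟨_≔_⟩

_⟨_≔_⟩ : (Fin n → A) → Fin n → A → Fin n → A
(f ⟨ v ≔ x ⟩) w = if does (w ≟ v) then x else f w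

⟨≔⟩-elim : (P : A → Set) {f : Fin n → A} (v : Fin n) {x : A} (w : Fin n) →
           (w ≡ v → P x) → (w ≢ v → P (f w)) → P ((f ⟨ v ≔ x ⟩) w)
⟨≔⟩-elim P v w eq neq with w ≟ v
... | yes p = eq p
... | no ¬p = neq ¬p

⟨≔⟩-updates : (f : Fin n → A) (v : Fin n) {x : A} → (f ⟨ v ≔ x ⟩) v ≡ x
⟨≔⟩-updates f v = ⟨≔⟩-elim (_≡ _) {f} v v (λ _ → refl) (contradiction refl)

⟨≔⟩-minimal : (f : Fin n → A) {v w : Fin n} {x : A} → w ≢ v → (f ⟨ v ≔ x ⟩) w ≡ f w
⟨≔⟩-minimal f {v} {w} w≢v = ⟨≔⟩-elim (_≡ f w) {f} v w (λ p → contradiction p w≢v) (λ _ → refl)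

∑-mono-≤ : {f g : Fin n → ℕ} → (∀ v → f v ≤ g v) → ∑ f ≤ ∑ g
∑-mono-≤ {zero}  _ = z≤n
∑-mono-≤ {suc n} h = +-mono-≤ (h zero) (∑-mono-≤ (h ∘ suc))

∑-mono-< : {f g : Fin n → ℕ} → (∀ v → f v ≤ g v) → ∀ v → f v < g v → ∑ f < ∑ g
∑-mono-< h zero    lt = +-mono-<-≤ lt (∑-mono-≤ (h ∘ suc))
∑-mono-< h (suc v) lt = +-mono-≤-< (h zero) (∑-mono-< (h ∘ suc) v lt)

∑-⟨≔⟩ : (f : Fin n → ℕ) (v : Fin n) (x : ℕ) → ∑ (f ⟨ v ≔ x ⟩) + f v ≡ ∑ f + x
∑-⟨≔⟩ f zero    x = swap-ends x (∑ (f ∘ suc)) (f zero)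
  where
  swap-ends : ∀ a b c → a + b + c ≡ c + b + a
  swap-ends = solve-∀
∑-⟨≔⟩ f (suc v) x = begin
  f zero + ∑ ((f ∘ suc) ⟨ v ≔ x ⟩) + f (suc v)    ≡⟨ +-assoc (f zero) _ _ ⟩
  f zero + (∑ ((f ∘ suc) ⟨ v ≔ x ⟩) + f (suc v))  ≡⟨ cong (f zero +_) (∑-⟨≔⟩ (f ∘ suc) v x) ⟩
  f zero + (∑ (f ∘ suc) + x)                      ≡⟨ +-assoc (f zero) _ _ ⟨
  f zero + ∑ (f ∘ suc) + x                        ∎
  where open ≡-Reasoning

∑-cong : {f g : Fin n → ℕ} → f ≗ g → ∑ f ≡ ∑ g
∑-cong h = ≤-antisym (∑-mono-≤ (≤-reflexive ∘ h)) (∑-mono-≤ (≤-reflexive ∘ sym ∘ h))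

∑-+ : (f g : Fin n → ℕ) → ∑ (λ v → f v + g v) ≡ ∑ f + ∑ g
∑-+ {zero}  f g = refl
∑-+ {suc n} f g = trans (cong (f zero + g zero +_) (∑-+ (f ∘ suc) (g ∘ suc)))
                        (exchange (f zero) (g zero) (∑ (f ∘ suc)) (∑ (g ∘ suc)))
  where
  exchange : ∀ a b c d → a + b + (c + d) ≡ a + c + (b + d)
  exchange = solve-∀

∑-const : ∀ n c → ∑ {n} (λ _ → c) ≡ n * c
∑-const zero    c = refl
∑-const (suc n) c = cong (c +_) (∑-const n c)

indicator : Subset n → Fin n → ℕ
indicator S v = if Vec.lookup S v then 1 else 0

∈⇒indicator : {S : Subset n} {v : Fin n} → v ∈ₛ S → indicator S v ≡ 1
∈⇒indicator {S = S} v∈S = cong (if_then 1 else 0) (Vec.[]=⇒lookup v∈S)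

∑-indicator : (S : Subset n) → ∑ (indicator S) ≡ ∣ S ∣
∑-indicator Vec.[]            = refl
∑-indicator (true  Vec.∷ S) = cong suc (∑-indicator S)
∑-indicator (false Vec.∷ S) = ∑-indicator S

module _ {P : Fin n → Set} (P? : ∀ v → Dec (P v)) where

  comprehension : Subset n
  comprehension = Vec.tabulate (does ∘ P?)

  lookup-comprehension : ∀ v → Vec.lookup comprehension v ≡ does (P? v)
  lookup-comprehension = Vec.lookup∘tabulate (does ∘ P?)

  ∈-comprehension : ∀ v → v ∈ₛ comprehension ⇔ P v
  ∈-comprehension v = mk⇔ to from
    where
    to : v ∈ₛ comprehension → P v
    to v∈ with P? v | trans (sym (lookup-comprehension v)) (Vec.[]=⇒lookup v∈)
    ... | yes p | _  = p
    ... | no  _ | ()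
    from : P v → v ∈ₛ comprehension
    from p with P? v | lookup-comprehension v
    ... | yes _ | eq = Vec.lookup⇒[]= v comprehension eq
    ... | no ¬p | _  = contradiction p ¬p

-- Graphs given by edge lists

Link : List (A × A) → Rel A 0ℓ
Link es u v = (u , v) ∈ es ⊎ (v , u) ∈ es

Link-sym : {es : List (A × A)} → Symmetric (Link es)
Link-sym = Sum.swap

link? : (es : List (Fin n × Fin n)) → Decidable (Link es)
link? es u v = ((u , v) ∈? es) ⊎-dec ((v , u) ∈? es)
  where open import Data.List.Membership.DecPropositional (≡-dec _≟_ _≟_) using (_∈?_)

Star-Link? : (es : List (Fin n × Fin n)) → Decidable (Star (Link es))
Star-Link? [] a b = map′ (λ { refl → ε }) only-ε (a ≟ b)
  where
  only-ε : Star (Link []) a b → a ≡ b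
  only-ε ε              = refl
  only-ε (inj₁ () ◅ _)
  only-ε (inj₂ () ◅ _)
Star-Link? ((p , q) ∷ es) a b =
  map′ from to (a ⇝? b ⊎-dec ((a ⇝? p ×-dec q ⇝? b) ⊎-dec (a ⇝? q ×-dec p ⇝? b)))
  where
  _⇝_ = Star (Link es)
  _⇝?_ = Star-Link? es

  Via : Fin _ → Set
  Via x = x ⇝ b ⊎ (x ⇝ p × q ⇝ b) ⊎ (x ⇝ q × p ⇝ b)

  weaken : ∀ {x y} → x ⇝ y → Star (Link ((p , q) ∷ es)) x y
  weaken = Star.map (Sum.map there there)

  from : Via a → Star (Link ((p , q) ∷ es)) a b
  from (inj₁ s)              = weaken s
  from (inj₂ (inj₁ (s , t))) = weaken s ◅◅ inj₁ (here refl) ◅ weaken t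
  from (inj₂ (inj₂ (s , t))) = weaken s ◅◅ inj₂ (here refl) ◅ weaken t

  prepend : ∀ {x y} → Link es x y → Via y → Via x
  prepend l = Sum.map (l ◅_) (Sum.map (map₁ (l ◅_)) (map₁ (l ◅_)))

  to : ∀ {x} → Star (Link ((p , q) ∷ es)) x b → Via x
  to ε                      = inj₁ ε
  to (inj₁ (there l) ◅ s)   = prepend (inj₁ l) (to s)
  to (inj₂ (there l) ◅ s)   = prepend (inj₂ l) (to s)
  to (inj₁ (here refl) ◅ s) with to s
  ... | inj₁ t              = inj₂ (inj₁ (ε , t))
  ... | inj₂ (inj₁ (_ , t)) = inj₂ (inj₁ (ε , t))
  ... | inj₂ (inj₂ (_ , t)) = inj₁ t
  to (inj₂ (here refl) ◅ s) with to s
  ... | inj₁ t              = inj₂ (inj₂ (ε , t))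
  ... | inj₂ (inj₁ (_ , t)) = inj₁ t
  ... | inj₂ (inj₂ (_ , t)) = inj₂ (inj₂ (ε , t))

-- Every edge joins a leaf of the graph formed by itself and the later edges
-- (its first component) to the rest of that graph.
LeafElimination : List (A × A) → Set
LeafElimination = AllPairs λ e f → proj₁ e ≢ proj₁ f × proj₁ e ≢ proj₂ f

Loopless : List (A × A) → Set
Loopless = All λ e → proj₁ e ≢ proj₂ e

TwoNeighbours : Rel A 0ℓ → List A → A → Set
TwoNeighbours R W x = ∃₂ λ y z → y ≢ z × (y ∈ W × R x y) × (z ∈ W × R x z)

LeafElimination⇒no-core : {es : List (A × A)} → LeafElimination es → Loopless es →
  ∀ {W x} → x ∈ W → ¬ (∀ {x} → x ∈ W → TwoNeighbours (Link es) W x)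
LeafElimination⇒no-core [] [] x∈W core with core x∈W
... | _ , _ , _ , (_ , inj₁ ()) , _
... | _ , _ , _ , (_ , inj₂ ()) , _
LeafElimination⇒no-core {es = (v , p) ∷ es} (leaf ∷ elim) (v≢p ∷ loopless) {W} x∈W core =
  LeafElimination⇒no-core elim loopless x∈W λ x∈ →
    let y , z , y≢z , (y∈ , l) , (z∈ , l′) = core x∈
    in  y , z , y≢z , (y∈ , later x∈ y∈ l) , (z∈ , later x∈ z∈ l′)
  where
  only-p : ∀ {y} → Link ((v , p) ∷ es) v y → y ≡ p
  only-p (inj₁ (here refl)) = refl
  only-p (inj₁ (there e))   = contradiction refl (proj₁ (All.lookup leaf e))
  only-p (inj₂ (here refl)) = contradiction refl v≢p
  only-p (inj₂ (there e))   = contradiction refl (proj₂ (All.lookup leaf e))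

  v∉W : v ∉ W
  v∉W v∈ = let _ , _ , y≢z , (_ , l) , (_ , l′) = core v∈
           in  y≢z (trans (only-p l) (sym (only-p l′)))

  later : ∀ {x y} → x ∈ W → y ∈ W → Link ((v , p) ∷ es) x y → Link es x y
  later x∈ y∈ (inj₁ (here refl)) = contradiction x∈ v∉W
  later x∈ y∈ (inj₁ (there e))   = inj₁ e
  later x∈ y∈ (inj₂ (here refl)) = contradiction y∈ v∉W
  later x∈ y∈ (inj₂ (there e))   = inj₂ e

module _ {R : Rel A 0ℓ} (symm : Symmetric R) where

  penultimate : ∀ a xs {c} → Linked R (a ∷ xs ∷ʳ c) → ∃ λ y → y ∈ a ∷ xs × R y c
  penultimate a []       (r ∷ _) = a , here refl , r
  penultimate a (x ∷ xs) (_ ∷ l) = map₂ (map₁ there) (penultimate x xs l)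

  interior-TwoNeighbours : ∀ a xs {c} → Linked R (a ∷ xs ∷ʳ c) → Unique (a ∷ xs) →
    c ∉ a ∷ xs → ∀ {x} → x ∈ xs → TwoNeighbours R (c ∷ a ∷ xs) x
  interior-TwoNeighbours a (x ∷ []) {c} (r ∷ r′ ∷ _) u c∉ (here refl) =
    a , c , (λ { refl → c∉ (here refl) }) , (there (here refl) , symm r) , (here refl , r′)
  interior-TwoNeighbours a (x ∷ y ∷ xs) (r ∷ r′ ∷ _) ((_ ∷ a≢y ∷ _) ∷ _) c∉ (here refl) =
    a , y , a≢y , (there (here refl) , symm r) , (there (there (there (here refl))) , r′)
  interior-TwoNeighbours a (x ∷ xs) (_ ∷ l) (_ ∷ u) c∉ (there x∈) =
    let y , z , y≢z , (y∈ , r) , (z∈ , r′) = interior-TwoNeighbours x xs l u (c∉ ∘ there) x∈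
    in  y , z , y≢z , (weaken y∈ , r) , (weaken z∈ , r′)
    where
    weaken : ∀ {c w} → w ∈ c ∷ x ∷ xs → w ∈ c ∷ a ∷ x ∷ xs
    weaken (here p)  = here p
    weaken (there p) = there (there p)

  cycle-TwoNeighbours : ∀ v vs → 2 ≤ length vs → Unique (v ∷ vs) → Linked R (v ∷ vs ∷ʳ v) →
    ∀ {x} → x ∈ v ∷ vs → TwoNeighbours R (v ∷ vs) x
  cycle-TwoNeighbours v (_ ∷ []) (s≤s ()) _ _ _
  cycle-TwoNeighbours v (a ∷ b ∷ vs) _ (_ ∷ a∉ ∷ _) (r ∷ _ ∷ l) (here refl) =
    let y , y∈ , r′ = penultimate b vs l
    in  a , y , All.lookup a∉ y∈ , (there (here refl) , r) , (there (there y∈) , symm r′)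
  cycle-TwoNeighbours v (a ∷ b ∷ vs) _ ((_ ∷ v≢b ∷ _) ∷ _) (r ∷ r′ ∷ _) (there (here refl)) =
    v , b , v≢b , (here refl , symm r) , (there (there (here refl)) , r′)
  cycle-TwoNeighbours v (a ∷ b ∷ vs) _ (v∉ ∷ u) (_ ∷ l) (there (there x∈)) =
    interior-TwoNeighbours a (b ∷ vs) l u (λ v∈ → contradiction refl (All.lookup v∉ v∈)) x∈

-- Memory contents

≔-updates : (m : ℕ → ℕ) (a : ℕ) {x : ℕ} → (m [ a ≔ x ]) a ≡ x
≔-updates m a {x} = cong (if_then x else m a) (dec-true (a Nat.≟ a) refl)

≔-minimal : (m : ℕ → ℕ) {a b x : ℕ} → b ≢ a → (m [ a ≔ x ]) b ≡ m b
≔-minimal m {a} {b} {x} b≢a = cong (if_then x else m b) (dec-false (a Nat.≟ b) (b≢a ∘ sym))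

module _ {m : ℕ → ℕ} where

  StoredAt-++⁻ : ∀ {a} xs {ys} → StoredAt m a (xs ++ ys) →
                 StoredAt m a xs × StoredAt m (a + length xs) ys
  StoredAt-++⁻ {a} []       {ys} s       = tt , subst (λ b → StoredAt m b ys) (sym (+-identityʳ a)) s
  StoredAt-++⁻ {a} (x ∷ xs) {ys} (e , s) =
    let s₁ , s₂ = StoredAt-++⁻ xs s
    in  (e , s₁) , subst (λ b → StoredAt m b ys) (sym (+-suc a (length xs))) s₂

  StoredAt-++⁺ : ∀ {a} xs {ys} → StoredAt m a xs → StoredAt m (a + length xs) ys →
                 StoredAt m a (xs ++ ys)
  StoredAt-++⁺ {a} []       {ys} _       s  = subst (λ b → StoredAt m b ys) (+-identityʳ a) s
  StoredAt-++⁺ {a} (x ∷ xs) {ys} (e , s) s₂ =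
    e , StoredAt-++⁺ xs s (subst (λ b → StoredAt m b ys) (+-suc a (length xs)) s₂)

  StoredAt-cong : ∀ {m′ a} xs → (∀ b → a ≤ b → b < a + length xs → m′ b ≡ m b) →
                  StoredAt m a xs → StoredAt m′ a xs
  StoredAt-cong []       _ _       = tt
  StoredAt-cong {a = a} (x ∷ xs) h (e , s) =
    trans (h a ≤-refl (m<m+n a (s≤s z≤n))) e ,
    StoredAt-cong xs (λ b a<b b< → h b (<⇒≤ a<b) (subst (b <_) (sym (+-suc a (length xs))) b<)) s

  StoredAt-suc : ∀ {a} xs → StoredAt (m ∘ suc) a xs → StoredAt m (suc a) xs
  StoredAt-suc []       _       = tt
  StoredAt-suc (x ∷ xs) (e , s) = e , StoredAt-suc xs s

  StoredAt-tabulate⁺ : ∀ {a} {f : Fin n → ℕ} → (∀ v → m (a + toℕ v) ≡ f v) →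
                       StoredAt m a (tabulate f)
  StoredAt-tabulate⁺ {n = zero}  _ = tt
  StoredAt-tabulate⁺ {n = suc n} {a} h =
    trans (cong m (sym (+-identityʳ a))) (h zero) ,
    StoredAt-tabulate⁺ λ v → trans (cong m (sym (+-suc a (toℕ v)))) (h (suc v))

  StoredAt-tabulate⁻ : ∀ {a} {f : Fin n → ℕ} → StoredAt m a (tabulate f) →
                       ∀ v → m (a + toℕ v) ≡ f v
  StoredAt-tabulate⁻ {a = a} (e , _) zero    = trans (cong m (+-identityʳ a)) e
  StoredAt-tabulate⁻ {a = a} (_ , s) (suc v) =
    trans (cong m (+-suc a (toℕ v))) (StoredAt-tabulate⁻ s v)

  StoredAt-lookup : ∀ {a} (xs : List (Fin n)) → StoredAt m a (map toℕ xs) →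
                    ∀ j → m (a + toℕ j) ≡ toℕ (lookup xs j)
  StoredAt-lookup {a = a} (x ∷ xs) (e , _) zero    = trans (cong m (+-identityʳ a)) e
  StoredAt-lookup {a = a} (x ∷ xs) (_ , s) (suc j) =
    trans (cong m (+-suc a (toℕ j))) (StoredAt-lookup xs s j)

contents-stored : ∀ xs → StoredAt (contents xs) 0 xs
contents-stored []       = tt
contents-stored (x ∷ xs) = refl , StoredAt-suc xs (contents-stored xs)

contents-beyond : ∀ xs {a} → length xs ≤ a → contents xs a ≡ 0
contents-beyond []       _         = refl
contents-beyond (x ∷ xs) (s≤s len≤a) = contents-beyond xs len≤a

bitVector≡tabulate : (S : Subset n) → bitVector S ≡ tabulate (indicator S)
bitVector≡tabulate Vec.[]      = refl
bitVector≡tabulate (b Vec.∷ S) = cong (_ ∷_) (bitVector≡tabulate S)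

length-bitVector : (S : Subset n) → length (bitVector S) ≡ n
length-bitVector S = trans (cong length (bitVector≡tabulate S)) (length-tabulate (indicator S))

-- Input encoding

blockStart : ℕ → (Fin n → List A) → Fin n → ℕ
blockStart a f zero    = a
blockStart a f (suc v) = blockStart (a + suc (length (f zero))) (f ∘ suc) v

blocksLength : (Fin n → List A) → ℕ
blocksLength f = ∑ (suc ∘ length ∘ f)

blockStart-≥ : ∀ a (f : Fin n → List A) v → a ≤ blockStart a f v
blockStart-≥ a f zero    = ≤-refl
blockStart-≥ a f (suc v) = ≤-trans (m≤m+n a _) (blockStart-≥ _ (f ∘ suc) v)

blockStart-end : ∀ a (f : Fin n → List A) v →
                 blockStart a f v + suc (length (f v)) ≤ a + blocksLength f
blockStart-end a f zero    = +-monoʳ-≤ a (m≤m+n _ _)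
blockStart-end a f (suc v) =
  ≤-trans (blockStart-end _ (f ∘ suc) v)
          (≤-reflexive (+-assoc a (suc (length (f zero))) (blocksLength (f ∘ suc))))

blockStart-last : ∀ a (f : Fin (suc n) → List A) →
  blockStart a f (Fin.fromℕ n) + suc (length (f (Fin.fromℕ n))) ≡ a + blocksLength f
blockStart-last {zero}  a f = cong (a +_) (sym (+-identityʳ _))
blockStart-last {suc n} a f = trans (blockStart-last _ (f ∘ suc)) (+-assoc a _ _)

blockStart-< : ∀ a (f : Fin n → List A) {v w} → v Fin.< w →
               blockStart a f v + suc (length (f v)) ≤ blockStart a f w
blockStart-< a f {zero}  {suc w} _         = blockStart-≥ _ (f ∘ suc) w
blockStart-< a f {suc v} {suc w} (s≤s v<w) = blockStart-< _ (f ∘ suc) v<w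

blockStart-disjoint : ∀ a (f : Fin n → List A) {v w i j} → v ≢ w →
  i ≤ length (f v) → j ≤ length (f w) → blockStart a f v + i ≢ blockStart a f w + j
blockStart-disjoint a f {v} {w} {i} {j} v≢w i≤ j≤ eq with Fin.<-cmp v w
... | tri< v<w _ _ = <⇒≢ (<-≤-trans (+-monoʳ-< (blockStart a f v) (s≤s i≤))
                         (≤-trans (blockStart-< a f v<w) (m≤m+n _ j))) eq
... | tri≈ _ v≡w _ = v≢w v≡w
... | tri> _ _ w<v = <⇒≢ (<-≤-trans (+-monoʳ-< (blockStart a f w) (s≤s j≤))
                         (≤-trans (blockStart-< a f w<v) (m≤m+n _ i))) (sym eq)

length-blockAddresses : ∀ a (ls : List (List (Fin n))) → length (blockAddresses a ls) ≡ length ls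
length-blockAddresses a []       = refl
length-blockAddresses a (l ∷ ls) = cong suc (length-blockAddresses _ ls)

length-blocks : ∀ {k} (f : Fin n → List (Fin k)) → length (blocks (tabulate f)) ≡ blocksLength f
length-blocks {zero}  f = refl
length-blocks {suc n} f = trans (length-++ (length (f zero) ∷ map toℕ (f zero)))
  (cong₂ _+_ (cong suc (length-map toℕ (f zero))) (length-blocks (f ∘ suc)))

stored-blockAddresses : ∀ {k m} b a (f : Fin n → List (Fin k)) →
  StoredAt m b (blockAddresses a (tabulate f)) → ∀ v → m (b + toℕ v) ≡ blockStart a f v
stored-blockAddresses {m = m} b a f (e , _) zero    = trans (cong m (+-identityʳ b)) e
stored-blockAddresses {m = m} b a f (_ , s) (suc v) =
  trans (cong m (+-suc b (toℕ v))) (stored-blockAddresses (suc b) _ (f ∘ suc) s v)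

stored-blocks : ∀ {k m} a (f : Fin n → List (Fin k)) → StoredAt m a (blocks (tabulate f)) →
                ∀ v → StoredAt m (blockStart a f v) (length (f v) ∷ map toℕ (f v))
stored-blocks a f s zero = proj₁ (StoredAt-++⁻ (length (f zero) ∷ map toℕ (f zero)) s)
stored-blocks {m = m} a f s (suc v) = stored-blocks _ (f ∘ suc)
  (subst (λ len → StoredAt m (a + suc len) (blocks (tabulate (f ∘ suc)))) (length-map toℕ (f zero))
    (proj₂ (StoredAt-++⁻ (length (f zero) ∷ map toℕ (f zero)) s)))
  v

module _ {G : Graph n} (L : AdjacencyLists G) where
  open Graph G
  open AdjacencyLists L

  private
    edges : List (Fin n × Fin n)
    edges = filter (λ e → (proj₁ e Fin.<? proj₂ e) ×-dec adj? (proj₁ e) (proj₂ e))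
                   (cartesianProduct (allFin n) (allFin n))

    arcsFrom : Fin n → List (Fin n × Fin n)
    arcsFrom u = map (u ,_) (nbrs u)

    arcs : List (Fin n × Fin n)
    arcs = concat (tabulate arcsFrom)

    ∈-arcsFrom⁻ : ∀ {u e} → e ∈ arcsFrom u → proj₁ e ≡ u × proj₂ e ∈ nbrs u
    ∈-arcsFrom⁻ e∈ with ∈-map⁻ _ e∈
    ... | _ , v∈ , refl = refl , v∈

    arcs-unique : Unique arcs
    arcs-unique = Unique.concat⁺
      (All.tabulate⁺ λ u → Unique.map⁺ (cong proj₂) (once u))
      (AllPairs.tabulate⁺ λ u≢v (e∈ , e∈′) →
        u≢v (trans (sym (proj₁ (∈-arcsFrom⁻ e∈))) (proj₁ (∈-arcsFrom⁻ e∈′))))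

    arc∈ : ∀ {u v} → Adj u v → (u , v) ∈ edges ++ map swap edges
    arc∈ {u} {v} uv with Fin.<-cmp u v
    ... | tri< u<v _ _  = ∈-++⁺ˡ (∈-filter⁺ _ (∈-cartesianProduct⁺ (∈-allFin u) (∈-allFin v)) (u<v , uv))
    ... | tri≈ _ refl _ = contradiction uv (irrefl refl)
    ... | tri> _ _ v<u  = ∈-++⁺ʳ edges (∈-map⁺ swap
      (∈-filter⁺ _ (∈-cartesianProduct⁺ (∈-allFin v) (∈-allFin u)) (v<u , symm uv)))

    arcs⊆ : ∀ {e} → e ∈ arcs → e ∈ edges ++ map swap edges
    arcs⊆ {u , v} e∈ with ∈-concat⁻′ (tabulate arcsFrom) e∈
    ... | _ , e∈l , l∈ with ∈-tabulate⁻ l∈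
    ... | w , refl with ∈-arcsFrom⁻ e∈l
    ... | refl , v∈ = arc∈ (Equivalence.to (listed u v) v∈)

    length-concat-tabulate : ∀ {k} (f : Fin k → List A) → length (concat (tabulate f)) ≡ ∑ (length ∘ f)
    length-concat-tabulate {k = zero}  f = refl
    length-concat-tabulate {k = suc k} f =
      trans (length-++ (f zero)) (cong (length (f zero) +_) (length-concat-tabulate (f ∘ suc)))

  ∑-degree≤ : ∑ (length ∘ nbrs) ≤ 2 * edgeCount
  ∑-degree≤ = begin
    ∑ (length ∘ nbrs)                      ≡⟨ ∑-cong (λ u → length-map (u ,_) (nbrs u)) ⟨
    ∑ (length ∘ arcsFrom)                  ≡⟨ length-concat-tabulate arcsFrom ⟨
    length arcs                            ≤⟨ Unique-⊆⇒length-≤ arcs-unique arcs⊆ ⟩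
    length (edges ++ map swap edges)       ≡⟨ length-++ edges ⟩
    edgeCount + length (map swap edges)    ≡⟨ cong (edgeCount +_) (length-map swap edges) ⟩
    edgeCount + edgeCount                  ≡⟨ cong (edgeCount +_) (+-identityʳ edgeCount) ⟨
    2 * edgeCount                          ∎
    where open ≤-Reasoning

data Status : Set where
  new active done : Status

active≢new : {s : Status} → s ≡ active → s ≢ new
active≢new refl ()

done≢new : {s : Status} → s ≡ done → s ≢ new
done≢new refl ()

active≢done : {s : Status} → s ≡ active → s ≢ done
active≢done refl ()

rank : Status → ℕ
rank new    = 2
rank active = 1
rank done   = 0

weightOf : Status → ℕ → ℕ
weightOf done x = 2 * x
weightOf _    x = x

children : List (Fin n × Fin n) → Fin n → List (Fin n × Fin n)
children es v = filter (λ e → proj₂ e ≟ v) es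

children-∷ʳ-≡ : ∀ (es : List (Fin n × Fin n)) {v p} →
                length (children (es ∷ʳ (v , p)) p) ≡ suc (length (children es p))
children-∷ʳ-≡ es {v} {p} = begin
  length (children (es ∷ʳ (v , p)) p)
    ≡⟨ cong length (filter-++ (λ e → proj₂ e ≟ p) es _) ⟩
  length (children es p ++ children ((v , p) ∷ []) p)
    ≡⟨ cong (λ l → length (children es p ++ l)) (filter-accept (λ e → proj₂ e ≟ p) refl) ⟩
  length (children es p ∷ʳ (v , p))
    ≡⟨ length-++ (children es p) ⟩
  length (children es p) + 1
    ≡⟨ +-comm _ 1 ⟩
  suc (length (children es p)) ∎
  where open ≡-Reasoning

children-∷ʳ-≢ : ∀ (es : List (Fin n × Fin n)) {v p w} → p ≢ w →
                length (children (es ∷ʳ (v , p)) w) ≡ length (children es w)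
children-∷ʳ-≢ es {v} {p} {w} p≢w = begin
  length (children (es ∷ʳ (v , p)) w)
    ≡⟨ cong length (filter-++ (λ e → proj₂ e ≟ w) es _) ⟩
  length (children es w ++ children ((v , p) ∷ []) w)
    ≡⟨ cong (λ l → length (children es w ++ l)) (filter-reject (λ e → proj₂ e ≟ w) p≢w) ⟩
  length (children es w ++ [])
    ≡⟨ cong length (++-identityʳ (children es w)) ⟩
  length (children es w) ∎
  where open ≡-Reasoning

Bottom : ℕ → List (Fin n) → Set
Bottom c []          = Unit
Bottom c (v ∷ [])    = suc (toℕ v) ≡ c
Bottom c (_ ∷ w ∷ s) = Bottom c (w ∷ s)

-- The depth-first search

module DepthFirst {n : ℕ} {G : Graph n} (L : AdjacencyLists G) (U : Subset n) where
  open Graph G using (Adj)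
  open AdjacencyLists L

  record Config : Set where
    field
      -- The entries of nbrs v from position rem v on have been scanned.
      rem    : Fin n → ℕ
      -- Up to the moment v is popped, val v counts the children that were
      -- linked to v, plus one if v is a terminal.  Afterwards it is 1 if that
      -- count has reached 3, and 0 otherwise.
      val    : Fin n → ℕ
      status : Fin n → Status
      root   : Fin n → Fin n
      stack  : List (Fin n)
      tree   : List (Fin n × Fin n)
      cursor : ℕ

    weight : Fin n → ℕ
    weight v = weightOf (status v) (val v)

    μ : ℕ
    μ = (n ∸ cursor) + ∑ (λ v → rank (status v) + rem v)

  open Config

  start : Config
  start = record
    { rem = length ∘ nbrs ; val = indicator U ; status = λ _ → new ; root = id
    ; stack = [] ; tree = [] ; cursor = 0 }

  skip : Config → Config
  skip σ = record σ { cursor = suc (cursor σ) }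

  visit : Fin n → (r : Fin n) (c : ℕ) → Config → Config
  visit x r c σ = record σ
    { status = status σ ⟨ x ≔ active ⟩ ; root = root σ ⟨ x ≔ r ⟩
    ; stack = x ∷ stack σ ; cursor = c }

  scan : Fin n → ℕ → Config → Config
  scan v j σ = record σ { rem = rem σ ⟨ v ≔ j ⟩ }

  finish : Fin n → List (Fin n) → Config → Config
  finish v s σ = record σ
    { val = val σ ⟨ v ≔ val σ v / 3 ⟩ ; status = status σ ⟨ v ≔ done ⟩ ; stack = s }

  link : Fin n → Fin n → Config → Config
  link v p σ = record σ { val = val σ ⟨ p ≔ suc (val σ p) ⟩ ; tree = tree σ ∷ʳ (v , p) }

  record Core (σ : Config) : Set where
    field
      cursor≤        : cursor σ ≤ n
      visited-before : ∀ v → toℕ v < cursor σ → status σ v ≢ new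
      stack⇒active   : ∀ {v} → v ∈ stack σ → status σ v ≡ active
      active⇒stack   : ∀ {v} → status σ v ≡ active → v ∈ stack σ
      stack-unique   : Unique (stack σ)
      stack-path     : Linked (λ v p → Adj p v) (stack σ)
      stack-root     : ∀ {v} → v ∈ stack σ → suc (toℕ (root σ v)) ≡ cursor σ
      stack-bottom   : Bottom (cursor σ) (stack σ)
      stack-val      : ∀ {v} → v ∈ stack σ → val σ v ≤ 3
      stack-tail-val : All (λ v → val σ v < 3) (drop 1 (stack σ))
      root<cursor    : ∀ v → status σ v ≢ new → toℕ (root σ v) < cursor σ
      rem≤           : ∀ v → rem σ v ≤ length (nbrs v)
      new-rem        : ∀ v → status σ v ≡ new → rem σ v ≡ length (nbrs v)
      new-val        : ∀ v → status σ v ≡ new → val σ v ≡ indicator U v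
      done-val       : ∀ v → status σ v ≡ done → val σ v ≡ 1 ⊎ (val σ v ≡ 0 × rem σ v ≡ 0)
      scanned        : ∀ v j → rem σ v ≤ toℕ j → status σ (lookup (nbrs v) j) ≢ new ×
                         toℕ (root σ (lookup (nbrs v) j)) ≤ toℕ (root σ v)
      tree-adj       : All (λ e → Adj (proj₁ e) (proj₂ e)) (tree σ)
      tree-done      : All (λ e → status σ (proj₁ e) ≡ done) (tree σ)
      tree-leaf      : LeafElimination (tree σ)
      children≤3     : ∀ v → length (children (tree σ) v) ≤ 3
      children≤val   : ∀ v → status σ v ≢ done → length (children (tree σ) v) ≤ val σ v

  open Core

  Reach : Config → Set
  Reach σ = ∀ {u} → u ∈ₛ U → status σ u ≢ new →
    ∃ λ w → Star (Link (tree σ)) u w ×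
      ((w ∈ stack σ × 0 < val σ w × root σ u ≡ root σ w) ⊎ w ≡ root σ u)

  record Inv (σ : Config) : Set where
    field
      core   : Core σ
      reach  : Reach σ
      tokens : ∑ (weight σ) ≤ ∣ U ∣

  open Inv

  start-inv : Inv start
  start-inv = record
    { core = record
      { cursor≤ = z≤n ; visited-before = λ _ ()
      ; stack⇒active = λ () ; active⇒stack = λ () ; stack-unique = [] ; stack-path = []
      ; stack-root = λ () ; stack-bottom = tt ; stack-val = λ () ; stack-tail-val = []
      ; root<cursor = λ _ v≢new → contradiction refl v≢new
      ; rem≤ = λ _ → ≤-refl ; new-rem = λ _ _ → refl ; new-val = λ _ _ → refl
      ; done-val = λ _ ()
      ; scanned = λ v j len≤j → contradiction (toℕ<n j) (≤⇒≯ len≤j)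
      ; tree-adj = [] ; tree-done = [] ; tree-leaf = []
      ; children≤3 = λ _ → z≤n ; children≤val = λ _ _ → z≤n }
    ; reach  = λ _ u≢new → contradiction refl u≢new
    ; tokens = ≤-reflexive (∑-indicator U) }

  skip-inv : ∀ {σ} → Inv σ → stack σ ≡ [] → cursor σ < n →
             (∀ v → toℕ v ≡ cursor σ → status σ v ≢ new) → Inv (skip σ)
  skip-inv {σ} I empty c<n visited = record
    { core = record
      { Core C
      ; cursor≤ = c<n
      ; visited-before = λ v v<sc → Sum.[ visited-before C v , visited v ] (m≤n⇒m<n∨m≡n (s≤s⁻¹ v<sc))
      ; stack-root = λ v∈ → contradiction (subst (_ ∈_) empty v∈) λ ()
      ; stack-bottom = subst (Bottom _) (sym empty) tt
      ; root<cursor = λ v → m<n⇒m<1+n ∘ root<cursor C v }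
    ; reach = reach I ; tokens = tokens I }
    where C = core I

  module _ {σ : Config} (I : Inv σ) (x r : Fin n) (c : ℕ)
           (x-new : status σ x ≡ new)
           (c≤n : c ≤ n) (cursor≤c : cursor σ ≤ c)
           (before : ∀ v → toℕ v < c → v ≡ x ⊎ toℕ v < cursor σ)
           (r<c : suc (toℕ r) ≡ c)
           (roots : ∀ {v} → v ∈ stack σ → suc (toℕ (root σ v)) ≡ c)
           (path : Linked (λ v p → Adj p v) (x ∷ stack σ))
           (bottom : Bottom c (x ∷ stack σ))
           (vals : All (λ v → val σ v < 3) (stack σ)) where
    private
      C = core I

      indicator≤1 : ∀ (S : Subset n) v → indicator S v ≤ 1
      indicator≤1 S v with Vec.lookup S v
      ... | true  = s≤s z≤n
      ... | false = z≤n

      stack≢x : ∀ {v} → v ∈ stack σ → v ≢ x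
      stack≢x v∈ refl = active≢new (stack⇒active C v∈) x-new

      visited≢x : ∀ {v} → status σ v ≢ new → v ≢ x
      visited≢x v≢new refl = v≢new x-new

      visit-visited : ∀ {v} → status σ v ≢ new → (status σ ⟨ x ≔ active ⟩) v ≢ new
      visit-visited {v} v≢new = subst (_≢ new) (sym (⟨≔⟩-minimal (status σ) (visited≢x v≢new))) v≢new

      visit-root : ∀ {v} → status σ v ≢ new → (root σ ⟨ x ≔ r ⟩) v ≡ root σ v
      visit-root v≢new = ⟨≔⟩-minimal (root σ) (visited≢x v≢new)

      visit-new : ∀ v → (status σ ⟨ x ≔ active ⟩) v ≡ new → status σ v ≡ new
      visit-new v = ⟨≔⟩-elim (λ s → s ≡ new → status σ v ≡ new) {status σ} x v
        (λ { refl _ → x-new }) (λ _ → id)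

    visit-inv : Inv (visit x r c σ)
    visit-inv = record
      { core = record
        { cursor≤ = c≤n
        ; visited-before = λ v v<c → ⟨≔⟩-elim (_≢ new) {status σ} x v (λ _ ())
            (λ v≢x → Sum.[ (λ v≡x → contradiction v≡x v≢x) , visited-before C v ] (before v v<c))
        ; stack⇒active = λ where
            (here refl) → ⟨≔⟩-updates (status σ) x
            (there v∈)  → trans (⟨≔⟩-minimal (status σ) (stack≢x v∈)) (stack⇒active C v∈)
        ; active⇒stack = λ {v} → ⟨≔⟩-elim (λ s → s ≡ active → v ∈ x ∷ stack σ) {status σ} x v
            (λ v≡x _ → here v≡x) (λ _ → there ∘ active⇒stack C)
        ; stack-unique = All.tabulate (λ v∈ x≡v → stack≢x v∈ (sym x≡v)) ∷ stack-unique C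
        ; stack-path = path
        ; stack-root = λ where
            (here refl) → trans (cong (suc ∘ toℕ) (⟨≔⟩-updates (root σ) x)) r<c
            (there v∈)  → trans (cong (suc ∘ toℕ) (visit-root (active≢new (stack⇒active C v∈)))) (roots v∈)
        ; stack-bottom = bottom
        ; stack-val = λ where
            (here refl) → ≤-trans (subst (_≤ 1) (sym (new-val C x x-new)) (indicator≤1 U x)) (s≤s z≤n)
            (there v∈)  → stack-val C v∈
        ; stack-tail-val = vals
        ; root<cursor = λ v v≢new → ⟨≔⟩-elim (λ w → toℕ w < c) {root σ} x v
            (λ _ → ≤-reflexive r<c)
            (λ v≢x → <-≤-trans
              (root<cursor C v (subst (_≢ new) (⟨≔⟩-minimal (status σ) v≢x) v≢new)) cursor≤c)
        ; rem≤ = rem≤ C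
        ; new-rem = λ v → new-rem C v ∘ visit-new v
        ; new-val = λ v → new-val C v ∘ visit-new v
        ; done-val = λ v → ⟨≔⟩-elim (λ s → s ≡ done → _) {status σ} x v (λ _ ()) (λ _ → done-val C v)
        ; scanned = λ v j rem≤j →
            let y≢new , y≤v = scanned C v j rem≤j
            in  visit-visited y≢new ,
                subst (λ z → toℕ z ≤ _) (sym (visit-root y≢new))
                  (⟨≔⟩-elim (λ z → toℕ (root σ (lookup (nbrs v) j)) ≤ toℕ z) {root σ} x v
                    (λ { refl → contradiction (toℕ<n j) (≤⇒≯ (subst (_≤ toℕ j) (new-rem C x x-new) rem≤j)) })
                    (λ _ → y≤v))
        ; tree-adj = tree-adj C
        ; tree-done = All.map (λ {e} e-done → trans
            (⟨≔⟩-minimal (status σ) (visited≢x (done≢new e-done))) e-done) (tree-done C)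
        ; tree-leaf = tree-leaf C
        ; children≤3 = children≤3 C
        ; children≤val = λ v → ⟨≔⟩-elim (λ s → s ≢ done → length (children (tree σ) v) ≤ val σ v)
            {status σ} x v
            (λ { refl _ → children≤val C x λ x-done → done≢new x-done x-new })
            (λ _ → children≤val C v) }
      ; reach = λ {u} u∈U → ⟨≔⟩-elim (λ s → s ≢ new → Goal u) {status σ} x u
          (λ { refl _ → x , ε , inj₁ (here refl ,
               subst (0 <_) (sym (trans (new-val C x x-new) (∈⇒indicator u∈U))) (s≤s z≤n) , refl) })
          (λ _ u≢new → old u∈U u≢new)
      ; tokens = subst (_≤ ∣ U ∣) (∑-cong λ v → sym (⟨≔⟩-elim (λ s → weightOf s (val σ v) ≡ weight σ v)
          {status σ} x v
          (λ { refl → sym (cong (λ s → weightOf s (val σ x)) x-new) }) (λ _ → refl))) (tokens I) }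
      where
      Goal : Fin n → Set
      Goal u = ∃ λ w → Star (Link (tree σ)) u w ×
        ((w ∈ x ∷ stack σ × 0 < val σ w × (root σ ⟨ x ≔ r ⟩) u ≡ (root σ ⟨ x ≔ r ⟩) w)
          ⊎ w ≡ (root σ ⟨ x ≔ r ⟩) u)
      old : ∀ {u} → u ∈ₛ U → status σ u ≢ new → Goal u
      old u∈U u≢new with reach I u∈U u≢new
      ... | w , s , inj₁ (w∈ , 0<w , eq) = w , s , inj₁ (there w∈ , 0<w ,
        trans (visit-root u≢new) (trans eq (sym (visit-root (active≢new (stack⇒active C w∈))))))
      ... | w , s , inj₂ eq = w , s , inj₂ (trans eq (sym (visit-root u≢new)))

  scan-inv : ∀ {σ} → Inv σ → ∀ v j → status σ v ≡ active → rem σ v ≡ suc j →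
    (∀ i → toℕ i ≡ j → status σ (lookup (nbrs v) i) ≢ new ×
                       toℕ (root σ (lookup (nbrs v) i)) ≤ toℕ (root σ v)) →
    Inv (scan v j σ)
  scan-inv {σ} I v j v-active rem≡ read = record
    { core = record
      { Core C
      ; rem≤ = λ w → ⟨≔⟩-elim (_≤ length (nbrs w)) {rem σ} v w
          (λ { refl → ≤-trans (n≤1+n j) (subst (_≤ length (nbrs v)) rem≡ (rem≤ C v)) })
          (λ _ → rem≤ C w)
      ; new-rem = λ w w-new → ⟨≔⟩-elim (_≡ length (nbrs w)) {rem σ} v w
          (λ { refl → contradiction w-new (active≢new v-active) })
          (λ _ → new-rem C w w-new)
      ; done-val = λ w w-done → ⟨≔⟩-elim (λ r → val σ w ≡ 1 ⊎ (val σ w ≡ 0 × r ≡ 0)) {rem σ} v w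
          (λ { refl → contradiction w-done (active≢done v-active) })
          (λ _ → done-val C w w-done)
      ; scanned = λ w i → ⟨≔⟩-elim (λ r → r ≤ toℕ i → _) {rem σ} v w
          (λ { refl j≤i → Sum.[ (λ j<i → scanned C v i (subst (_≤ toℕ i) (sym rem≡) j<i)) ,
                                (λ j≡i → read i (sym j≡i)) ] (m≤n⇒m<n∨m≡n j≤i) })
          (λ _ → scanned C w i) }
    ; reach = reach I ; tokens = tokens I }
    where C = core I

  module _ {σ : Config} (I : Inv σ) (v : Fin n) (s : List (Fin n))
           (stack≡ : stack σ ≡ v ∷ s) (full : val σ v ≡ 3 ⊎ rem σ v ≡ 0) where
    private
      C = core I

      v∈stack : v ∈ stack σ
      v∈stack = subst (v ∈_) (sym stack≡) (here refl)

      s⊆stack : ∀ {w} → w ∈ s → w ∈ stack σ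
      s⊆stack w∈ = subst (_ ∈_) (sym stack≡) (there w∈)

      v-active : status σ v ≡ active
      v-active = stack⇒active C v∈stack

      v∉s : All (v ≢_) s
      v∉s with subst Unique stack≡ (stack-unique C)
      ... | v≢ ∷ _ = v≢

      s≢v : ∀ {w} → w ∈ s → w ≢ v
      s≢v w∈ w≡v = All.lookup v∉s w∈ (sym w≡v)

      v-val : val σ v ≤ 3
      v-val = stack-val C v∈stack

      s-val : All (λ w → val σ w < 3) s
      s-val = subst (λ l → All (λ w → val σ w < 3) (drop 1 l)) stack≡ (stack-tail-val C)

      rest-path : ∀ {R : Rel (Fin n) 0ℓ} {w l} → Linked R (w ∷ l) → Linked R l
      rest-path [-]     = []
      rest-path (_ ∷ l) = l

      rest-bottom : ∀ {c} {w : Fin n} l → Bottom c (w ∷ l) → Bottom c l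
      rest-bottom []      _ = tt
      rest-bottom (_ ∷ _) b = b

      finish-val : ∀ {t} → t ≤ 3 → t ≡ 3 ⊎ rem σ v ≡ 0 → t / 3 ≡ 1 ⊎ (t / 3 ≡ 0 × rem σ v ≡ 0)
      finish-val {0} _ (inj₂ r≡0) = inj₂ (refl , r≡0)
      finish-val {1} _ (inj₂ r≡0) = inj₂ (refl , r≡0)
      finish-val {2} _ (inj₂ r≡0) = inj₂ (refl , r≡0)
      finish-val {3} _ _          = inj₁ refl
      finish-val {suc (suc (suc (suc _)))} (s≤s (s≤s (s≤s ()))) _

      finish-visited : ∀ w → (status σ ⟨ v ≔ done ⟩) w ≢ new → status σ w ≢ new
      finish-visited w = ⟨≔⟩-elim (λ t → t ≢ new → status σ w ≢ new) {status σ} v w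
        (λ { refl _ → active≢new v-active }) (λ _ → id)

      unfinished≢v : ∀ {w} → (status σ ⟨ v ≔ done ⟩) w ≢ done → w ≢ v
      unfinished≢v ≢done refl = ≢done (⟨≔⟩-updates (status σ) v)

      finish-unvisited : ∀ w → status σ w ≢ new → (status σ ⟨ v ≔ done ⟩) w ≢ new
      finish-unvisited w w≢new = ⟨≔⟩-elim (_≢ new) {status σ} v w (λ _ ()) (λ _ → w≢new)

      finish-new : ∀ w → (status σ ⟨ v ≔ done ⟩) w ≡ new → status σ w ≡ new
      finish-new w = ⟨≔⟩-elim (λ t → t ≡ new → status σ w ≡ new) {status σ} v w (λ _ ()) (λ _ → id)

    finish-core : Core (finish v s σ)
    finish-core = record
      { Core C
      ; visited-before = λ w w<c → finish-unvisited w (visited-before C w w<c)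
      ; stack⇒active = λ w∈ → trans (⟨≔⟩-minimal (status σ) (s≢v w∈)) (stack⇒active C (s⊆stack w∈))
      ; active⇒stack = λ {w} → ⟨≔⟩-elim (λ t → t ≡ active → w ∈ s) {status σ} v w (λ _ ())
          (λ w≢v w-active → Any.tail w≢v (subst (w ∈_) stack≡ (active⇒stack C w-active)))
      ; stack-unique = AllPairs.tail (subst Unique stack≡ (stack-unique C))
      ; stack-path = rest-path (subst (Linked _) stack≡ (stack-path C))
      ; stack-root = stack-root C ∘ s⊆stack
      ; stack-bottom = rest-bottom s (subst (Bottom (cursor σ)) stack≡ (stack-bottom C))
      ; stack-val = λ w∈ → subst (_≤ 3) (sym (⟨≔⟩-minimal (val σ) (s≢v w∈))) (stack-val C (s⊆stack w∈))
      ; stack-tail-val = All.drop⁺ 1 (All.tabulate λ w∈ →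
          subst (_< 3) (sym (⟨≔⟩-minimal (val σ) (s≢v w∈))) (All.lookup s-val w∈))
      ; root<cursor = λ w → root<cursor C w ∘ finish-visited w
      ; new-rem = λ w → new-rem C w ∘ finish-new w
      ; new-val = λ w w-new → trans
          (⟨≔⟩-minimal (val σ) (unfinished≢v λ w-done → done≢new w-done w-new))
          (new-val C w (finish-new w w-new))
      ; done-val = done-val′
      ; scanned = λ w j rem≤j → map₁ (finish-unvisited _) (scanned C w j rem≤j)
      ; tree-done = All.map (λ {e} e-done → ⟨≔⟩-elim (_≡ done) {status σ} v (proj₁ e) (λ _ → refl) (λ _ → e-done))
          (tree-done C)
      ; children≤val = λ w w≢done → subst (length (children (tree σ) w) ≤_)
          (sym (⟨≔⟩-minimal (val σ) (unfinished≢v w≢done)))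
          (children≤val C w (subst (_≢ done) (⟨≔⟩-minimal (status σ) (unfinished≢v w≢done)) w≢done)) }
      where
      done-val′ : ∀ w → (status σ ⟨ v ≔ done ⟩) w ≡ done →
        (val σ ⟨ v ≔ val σ v / 3 ⟩) w ≡ 1 ⊎ ((val σ ⟨ v ≔ val σ v / 3 ⟩) w ≡ 0 × rem σ w ≡ 0)
      done-val′ w with w ≟ v
      ... | yes refl = λ _ → finish-val v-val full
      ... | no  _    = done-val C w

    finish-tokens : ∑ (weight (finish v s σ)) + val σ v ≡ ∑ (weight σ) + 2 * (val σ v / 3)
    finish-tokens = begin
      ∑ (weight (finish v s σ)) + val σ v
        ≡⟨ cong₂ _+_ (∑-cong weight≗) (cong (λ t → weightOf t (val σ v)) (sym v-active)) ⟩
      ∑ (weight σ ⟨ v ≔ 2 * (val σ v / 3) ⟩) + weight σ v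
        ≡⟨ ∑-⟨≔⟩ (weight σ) v _ ⟩
      ∑ (weight σ) + 2 * (val σ v / 3) ∎
      where
      open ≡-Reasoning
      weight≗ : weight (finish v s σ) ≗ weight σ ⟨ v ≔ 2 * (val σ v / 3) ⟩
      weight≗ w with w ≟ v
      ... | yes _ = refl
      ... | no  _ = refl

    finish-inv : val σ v ≡ 0 ⊎ s ≡ [] → Inv (finish v s σ)
    finish-inv unlinked = record
      { core = finish-core
      ; reach = λ {u} u∈U u≢new → keep (reach I u∈U (finish-visited u u≢new))
      ; tokens = ≤-trans (+-cancelʳ-≤ (val σ v) _ _ (begin
          ∑ (weight (finish v s σ)) + val σ v  ≡⟨ finish-tokens ⟩
          ∑ (weight σ) + 2 * (val σ v / 3)     ≤⟨ +-monoʳ-≤ (∑ (weight σ)) (*-monoˡ-≤ (val σ v / 3) (n≤1+n 2)) ⟩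
          ∑ (weight σ) + 3 * (val σ v / 3)     ≡⟨ cong (∑ (weight σ) +_) (*-comm 3 (val σ v / 3)) ⟩
          ∑ (weight σ) + val σ v / 3 * 3       ≤⟨ +-monoʳ-≤ (∑ (weight σ)) (m/n*n≤m (val σ v) 3) ⟩
          ∑ (weight σ) + val σ v               ∎)) (tokens I) }
      where
      open ≤-Reasoning
      bottom≡root : s ≡ [] → v ≡ root σ v
      bottom≡root refl = toℕ-injective (suc-injective
        (trans (subst (Bottom (cursor σ)) stack≡ (stack-bottom C)) (sym (stack-root C v∈stack))))
      keep : ∀ {u} →
        (∃ λ w → Star (Link (tree σ)) u w ×
          ((w ∈ stack σ × 0 < val σ w × root σ u ≡ root σ w) ⊎ w ≡ root σ u)) →
        ∃ λ w → Star (Link (tree σ)) u w ×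
          ((w ∈ s × 0 < (val σ ⟨ v ≔ val σ v / 3 ⟩) w × root σ u ≡ root σ w) ⊎ w ≡ root σ u)
      keep (w , p , inj₂ eq) = w , p , inj₂ eq
      keep (w , p , inj₁ (w∈ , 0<w , eq)) with subst (w ∈_) stack≡ w∈
      ... | there w∈s  = w , p , inj₁ (w∈s , subst (0 <_) (sym (⟨≔⟩-minimal (val σ) (s≢v w∈s))) 0<w , eq)
      ... | here refl  = v , p , inj₂ (Sum.[ (λ val≡0 → contradiction (sym val≡0) (<⇒≢ 0<w)) ,
                                             (λ s≡[] → trans (bottom≡root s≡[]) (sym eq)) ] unlinked)

    module _ (p : Fin n) (s′ : List (Fin n)) (s≡ : s ≡ p ∷ s′) (useful : 0 < val σ v) where
      private
        C′ = finish-core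
        τ  = finish v s σ

        p∈s : p ∈ s
        p∈s = subst (p ∈_) (sym s≡) (here refl)

        p≢v : p ≢ v
        p≢v = s≢v p∈s

        p-active : status σ p ≡ active
        p-active = stack⇒active C (s⊆stack p∈s)

        p-active′ : status τ p ≡ active
        p-active′ = stack⇒active C′ p∈s

        val-p : val τ p ≡ val σ p
        val-p = ⟨≔⟩-minimal (val σ) p≢v

        done≢p : ∀ {w} → status τ w ≡ done → w ≢ p
        done≢p w-done refl = active≢done p-active′ w-done

        new≢p : ∀ {w} → status τ w ≡ new → w ≢ p
        new≢p w-new refl = active≢new p-active′ w-new

        tail≢p : All (_≢ p) (drop 1 s)
        tail≢p with subst Unique s≡ (stack-unique C′)
        ... | p∉ ∷ _ = subst (λ l → All (_≢ p) (drop 1 l)) (sym s≡) (All.map (_∘ sym) p∉)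

        v-p-adj : Adj v p
        v-p-adj with subst (Linked _) (trans stack≡ (cong (v ∷_) s≡)) (stack-path C)
        ... | e ∷ _ = Graph.symm G e

      link-inv : Inv (link v p τ)
      link-inv = record
        { core = record
          { Core C′
          ; stack-val = λ {w} w∈ → ⟨≔⟩-elim (_≤ 3) {val τ} p w
              (λ _ → subst (_< 3) (sym val-p) (All.lookup s-val p∈s)) (λ _ → stack-val C′ w∈)
          ; stack-tail-val = All.zipWith
              (λ { (w≢p , w<3) → subst (_< 3) (sym (⟨≔⟩-minimal (val τ) w≢p)) w<3 })
              (tail≢p , stack-tail-val C′)
          ; new-val = λ w w-new → trans (⟨≔⟩-minimal (val τ) (new≢p w-new)) (new-val C′ w w-new)
          ; done-val = λ w w-done →
              subst (λ x → x ≡ 1 ⊎ (x ≡ 0 × rem σ w ≡ 0)) (sym (⟨≔⟩-minimal (val τ) (done≢p w-done)))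
                (done-val C′ w w-done)
          ; tree-adj = All.++⁺ (tree-adj C) (v-p-adj ∷ [])
          ; tree-done = All.++⁺ (tree-done C′) (⟨≔⟩-updates (status σ) v ∷ [])
          ; tree-leaf = AllPairs.++⁺ (tree-leaf C) ([] ∷ []) (All.map (λ e-done →
              ((λ { refl → active≢done v-active e-done }) , (λ { refl → active≢done p-active e-done })) ∷ [])
              (tree-done C))
          ; children≤3 = λ w → by-parent w (_≤ 3)
              (λ { refl → ≤-trans (s≤s (children≤val C p (active≢done p-active))) (All.lookup s-val p∈s) })
              (children≤3 C w)
          ; children≤val = λ w w≢done → ⟨≔⟩-elim (length (children (tree σ ∷ʳ (v , p)) w) ≤_) {val τ} p w
              (λ { refl → subst (_≤ suc (val τ p)) (sym (children-∷ʳ-≡ (tree σ)))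
                     (s≤s (children≤val C′ p w≢done)) })
              (λ w≢p → subst (_≤ val τ w) (sym (children-∷ʳ-≢ (tree σ) (w≢p ∘ sym)))
                (children≤val C′ w w≢done)) }
        ; reach = λ {u} u∈U u≢new → keep (reach I u∈U (finish-visited u u≢new))
        ; tokens = +-cancelʳ-≤ (val σ v) _ _ (begin
            ∑ (weight (link v p τ)) + val σ v       ≡⟨ cong (_+ val σ v) link-tokens ⟩
            suc (∑ (weight τ) + val σ v)            ≡⟨ cong suc finish-tokens ⟩
            suc (∑ (weight σ) + 2 * (val σ v / 3))  ≡⟨ +-suc _ _ ⟨
            ∑ (weight σ) + suc (2 * (val σ v / 3))  ≤⟨ +-mono-≤ (tokens I) (hand-on _ v-val useful) ⟩
            ∣ U ∣ + val σ v                         ∎) }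
        where
        open ≤-Reasoning

        hand-on : ∀ t → t ≤ 3 → 0 < t → suc (2 * (t / 3)) ≤ t
        hand-on 1 _ _ = s≤s z≤n
        hand-on 2 _ _ = s≤s z≤n
        hand-on 3 _ _ = s≤s (s≤s (s≤s z≤n))
        hand-on (suc (suc (suc (suc _)))) (s≤s (s≤s (s≤s ()))) _

        by-parent : ∀ w (P : ℕ → Set) → (w ≡ p → P (suc (length (children (tree σ) w)))) →
          P (length (children (tree σ) w)) → P (length (children (tree σ ∷ʳ (v , p)) w))
        by-parent w P eq neq with w ≟ p
        ... | yes refl = subst P (sym (children-∷ʳ-≡ (tree σ))) (eq refl)
        ... | no  w≢p  = subst P (sym (children-∷ʳ-≢ (tree σ) (w≢p ∘ sym))) neq

        link-tokens : ∑ (weight (link v p τ)) ≡ suc (∑ (weight τ))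
        link-tokens = +-cancelʳ-≡ (weight τ p) _ _ (trans
          (cong (_+ weight τ p) (∑-cong weight≗))
          (trans (∑-⟨≔⟩ (weight τ) p _) (+-suc _ _)))
          where
          weight-p : weight τ p ≡ val τ p
          weight-p = cong (λ t → weightOf t (val τ p)) p-active′
          weight≗ : weight (link v p τ) ≗ weight τ ⟨ p ≔ suc (weight τ p) ⟩
          weight≗ w with w ≟ p
          ... | yes refl = trans (cong (λ t → weightOf t (suc (val τ p))) p-active′)
                                 (cong suc (sym weight-p))
          ... | no _     = refl

        extend : ∀ {a b} → Star (Link (tree σ)) a b → Star (Link (tree σ ∷ʳ (v , p))) a b
        extend = Star.map (Sum.map ∈-++⁺ˡ ∈-++⁺ˡ)

        0<val-p : 0 < (val τ ⟨ p ≔ suc (val τ p) ⟩) p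
        0<val-p = subst (0 <_) (sym (⟨≔⟩-updates (val τ) p)) (s≤s z≤n)

        keep : ∀ {u} →
          (∃ λ w → Star (Link (tree σ)) u w ×
            ((w ∈ stack σ × 0 < val σ w × root σ u ≡ root σ w) ⊎ w ≡ root σ u)) →
          ∃ λ w → Star (Link (tree σ ∷ʳ (v , p))) u w ×
            ((w ∈ s × 0 < (val τ ⟨ p ≔ suc (val τ p) ⟩) w × root σ u ≡ root σ w) ⊎ w ≡ root σ u)
        keep (w , q , inj₂ eq) = w , extend q , inj₂ eq
        keep {u} (w , q , inj₁ (w∈ , 0<w , eq)) with subst (w ∈_) stack≡ w∈
        ... | here refl = p , extend q ◅◅ inj₁ (∈-++⁺ʳ (tree σ) (here refl)) ◅ ε ,
          inj₁ (p∈s , 0<val-p , trans eq (toℕ-injective (suc-injective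
            (trans (stack-root C v∈stack) (sym (stack-root C (s⊆stack p∈s)))))))
        ... | there w∈s = w , extend q , inj₁ (w∈s ,
          ⟨≔⟩-elim (0 <_) {val τ} p w (λ _ → s≤s z≤n)
            (λ _ → subst (0 <_) (sym (⟨≔⟩-minimal (val σ) (s≢v w∈s))) 0<w) , eq)

  skip-μ : ∀ σ → cursor σ < n → μ (skip σ) < μ σ
  skip-μ σ c<n = +-monoˡ-< _ (∸-monoʳ-< ≤-refl c<n)

  visit-μ : ∀ σ x r {c} → status σ x ≡ new → cursor σ ≤ c → μ (visit x r c σ) < μ σ
  visit-μ σ x r {c} x-new ≤c = +-mono-≤-< (∸-monoʳ-≤ n ≤c) (∑-mono-<
    (λ v → ⟨≔⟩-elim (λ s → rank s + rem σ v ≤ rank (status σ v) + rem σ v) {status σ} x v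
      (λ { refl → <⇒≤ decrease }) (λ _ → ≤-refl))
    x (subst (λ s → rank s + rem σ x < rank (status σ x) + rem σ x) (sym (⟨≔⟩-updates (status σ) x)) decrease))
    where
    decrease : rank active + rem σ x < rank (status σ x) + rem σ x
    decrease = subst (λ s → rank active + rem σ x < rank s + rem σ x) (sym x-new) ≤-refl

  scan-μ : ∀ σ v {j} → rem σ v ≡ suc j → μ (scan v j σ) < μ σ
  scan-μ σ v {j} rem≡ = +-monoʳ-< (n ∸ cursor σ) (∑-mono-<
    (λ w → +-monoʳ-≤ (rank (status σ w)) (⟨≔⟩-elim (_≤ rem σ w) {rem σ} v w
      (λ { refl → <⇒≤ decrease }) (λ _ → ≤-refl)))
    v (+-monoʳ-< (rank (status σ v)) (subst (_< rem σ v) (sym (⟨≔⟩-updates (rem σ) v)) decrease)))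
    where
    decrease : j < rem σ v
    decrease = ≤-reflexive (sym rem≡)

  finish-μ : ∀ σ v s → status σ v ≡ active → μ (finish v s σ) < μ σ
  finish-μ σ v s v-active = +-monoʳ-< (n ∸ cursor σ) (∑-mono-<
    (λ w → ⟨≔⟩-elim (λ t → rank t + rem σ w ≤ rank (status σ w) + rem σ w) {status σ} v w
      (λ { refl → <⇒≤ decrease }) (λ _ → ≤-refl))
    v (subst (λ t → rank t + rem σ v < rank (status σ v) + rem σ v) (sym (⟨≔⟩-updates (status σ) v)) decrease))
    where
    decrease : rem σ v < rank (status σ v) + rem σ v
    decrease = subst (λ t → rem σ v < rank t + rem σ v) (sym v-active) ≤-refl

module Outcome {n : ℕ} {G : Graph n} (L : AdjacencyLists G) (U : Subset n)
               {σ : DepthFirst.Config L U} (I : DepthFirst.Inv L U σ)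
               (stack≡[] : DepthFirst.Config.stack σ ≡ [])
               (cursor≡n : DepthFirst.Config.cursor σ ≡ n) where
  open Graph G using (Adj; symm; irrefl)
  open AdjacencyLists L
  open DepthFirst L U using (Config)
  open Config σ
  open DepthFirst.Inv I
  open DepthFirst.Core core

  all-done : ∀ v → status v ≡ done
  all-done v = go (status v) refl
    where
    go : ∀ s → status v ≡ s → s ≡ done
    go new    v-new    = contradiction v-new
      (visited-before v (subst (toℕ v <_) (sym cursor≡n) (toℕ<n v)))
    go active v-active = contradiction (subst (v ∈_) stack≡[] (active⇒stack v-active)) λ ()
    go done   _        = refl

  X : Subset n
  X = comprehension λ v → val v Nat.≟ 1

  indicator-X : ∀ v → indicator X v ≡ val v
  indicator-X v = trans (cong (if_then 1 else 0) (lookup-comprehension (λ w → val w Nat.≟ 1) v))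
                        (bit (done-val v (all-done v)))
    where
    bit : ∀ {x} → x ≡ 1 ⊎ (x ≡ 0 × rem v ≡ 0) → (if does (x Nat.≟ 1) then 1 else 0) ≡ x
    bit (inj₁ refl)       = refl
    bit (inj₂ (refl , _)) = refl

  2∣X∣≤∣U∣ : 2 * ∣ X ∣ ≤ ∣ U ∣
  2∣X∣≤∣U∣ = begin
    2 * ∣ X ∣                                  ≡⟨ cong (2 *_) (∑-indicator X) ⟨
    2 * ∑ (indicator X)                        ≡⟨ cong (∑ (indicator X) +_) (+-identityʳ _) ⟩
    ∑ (indicator X) + ∑ (indicator X)          ≡⟨ ∑-+ (indicator X) (indicator X) ⟨
    ∑ (λ v → indicator X v + indicator X v)    ≡⟨ ∑-cong double ⟩
    ∑ (Config.weight σ)                        ≤⟨ tokens ⟩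
    ∣ U ∣                                      ∎
    where
    open ≤-Reasoning
    double : ∀ v → indicator X v + indicator X v ≡ Config.weight σ v
    double v = trans (cong₂ _+_ (indicator-X v) (trans (indicator-X v) (sym (+-identityʳ (val v)))))
                     (cong (λ s → weightOf s (val v)) (sym (all-done v)))

  T : Subgraph G
  T = record
    { V = ⊤ ; Adj = Link tree ; adj? = link? tree ; symm = Link-sym
    ; Adj⇒V = λ _ → ∈⊤
    ; Adj⇒G = Sum.[ All.lookup tree-adj , symm ∘ All.lookup tree-adj ] }

  tree-loopless : Loopless tree
  tree-loopless = All.map (λ e v≡p → irrefl v≡p e) tree-adj

  isForest : IsForest T
  isForest v vs (2≤ , u , l) = LeafElimination⇒no-core tree-leaf tree-loopless (here refl)
    (cycle-TwoNeighbours Link-sym v vs 2≤ u l)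

  isEdgeList : IsEdgeList T tree
  isEdgeList = record
    { listed = λ _ _ → mk⇔ id id
    ; once   = once′ tree-leaf }
    where
    once′ : ∀ {es : List (Fin n × Fin n)} → LeafElimination es → AllPairs (λ e f → e ≢ f × e ≢ swap f) es
    once′ = AllPairs.map λ (≢₁ , ≢₂) → (≢₁ ∘ cong proj₁) , (≢₂ ∘ cong proj₁)

  degree≤4 : ∀ v → Subgraph.degree T v ≤ 4
  degree≤4 v = begin
    length (filter (link? tree v) (allFin n))
      ≤⟨ Unique-⊆⇒length-≤ (Unique.filter⁺ (link? tree v) (Unique.allFin⁺ n)) neighbour∈ ⟩
    length (map proj₁ (children tree v) ++ map proj₂ (parents tree))
      ≡⟨ length-++ (map proj₁ (children tree v)) ⟩
    length (map proj₁ (children tree v)) + length (map proj₂ (parents tree))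
      ≡⟨ cong₂ _+_ (length-map proj₁ (children tree v)) (length-map proj₂ (parents tree)) ⟩
    length (children tree v) + length (parents tree)
      ≤⟨ +-mono-≤ (children≤3 v) (single (parents tree) (AllPairs.filter⁺ (λ e → proj₁ e ≟ v) tree-leaf)
           (All.all-filter (λ e → proj₁ e ≟ v) tree)) ⟩
    4 ∎
    where
    open ≤-Reasoning
    parents : List (Fin n × Fin n) → List (Fin n × Fin n)
    parents = filter (λ e → proj₁ e ≟ v)

    neighbour∈ : ∀ {w} → w ∈ filter (link? tree v) (allFin n) →
                 w ∈ map proj₁ (children tree v) ++ map proj₂ (parents tree)
    neighbour∈ w∈ with proj₂ (∈-filter⁻ (link? tree v) {xs = allFin n} w∈)
    ... | inj₁ e = ∈-++⁺ʳ (map proj₁ (children tree v))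
                     (∈-map⁺ proj₂ (∈-filter⁺ (λ e → proj₁ e ≟ v) e refl))
    ... | inj₂ e = ∈-++⁺ˡ (∈-map⁺ proj₁ (∈-filter⁺ (λ e → proj₂ e ≟ v) e refl))

    single : ∀ es → LeafElimination es → All (λ e → proj₁ e ≡ v) es → length es ≤ 1
    single []          _                       _               = z≤n
    single (_ ∷ [])    _                       _               = s≤s z≤n
    single (_ ∷ _ ∷ _) (((≢ , _) ∷ _) ∷ _) (eq ∷ eq′ ∷ _) = contradiction (trans eq (sym eq′)) ≢

  root-edge-≤ : ∀ {a b} → Adj a b → val a ≢ 1 → toℕ (root b) ≤ toℕ (root a)
  root-edge-≤ {a} {b} ab a≢1 with done-val a (all-done a)
  ... | inj₁ a≡1         = contradiction a≡1 a≢1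
  ... | inj₂ (_ , rem≡0) =
    subst (λ w → toℕ (root w) ≤ toℕ (root a)) (sym (Any.lookup-index b∈))
      (proj₂ (scanned a (Any.index b∈) (subst (_≤ toℕ (Any.index b∈)) (sym rem≡0) z≤n)))
    where
    b∈ : b ∈ nbrs a
    b∈ = Equivalence.from (listed a b) ab

  ∁X⇒val≢1 : ∀ {v} → v ∈ₛ ∁ X → val v ≢ 1
  ∁X⇒val≢1 {v} v∈ = x∈∁p⇒x∉p v∈ ∘ Equivalence.from (∈-comprehension (λ w → val w Nat.≟ 1) v)

  root-constant : ∀ {a b} → Star (Subgraph.Adj (G - X)) a b → root a ≡ root b
  root-constant ε = refl
  root-constant ((ab , a∉X , b∉X) ◅ s) = trans
    (toℕ-injective (≤-antisym (root-edge-≤ (symm ab) (∁X⇒val≢1 b∉X)) (root-edge-≤ ab (∁X⇒val≢1 a∉X))))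
    (root-constant s)

  reach-root : ∀ {u} → u ∈ₛ U → Star (Link tree) u (root u)
  reach-root {u} u∈U with reach u∈U (done≢new (all-done u))
  ... | _ , s , inj₂ refl     = s
  ... | _ , _ , inj₁ (w∈ , _) = contradiction (subst (_ ∈_) stack≡[] w∈) λ ()

  spans : ∀ C → IsComponent (G - X) C → ∃[ TC ] IsComponent T TC × U ∩ C ⊆ TC
  spans C (r , _ , C⇔) = comprehension reachable? , (root r , ∈⊤ , ∈-comprehension reachable?) ,
    λ {u} u∈ → let u∈U , u∈C = x∈p∩q⁻ U C u∈ in
      Equivalence.from (∈-comprehension reachable? u)
        (subst (λ w → Star (Link tree) w u) (sym (root-constant (Equivalence.to (C⇔ u) u∈C)))
          (Star.reverse Link-sym (reach-root u∈U)))
    where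
    reachable? = Star-Link? tree (root r)

-- The program

-- Registers 0, 6, 7, 9 hold the addresses of the values, of the marks of
-- visited vertices, of the number of tree edges and of the stack; 8 and 10
-- point behind the tree edges and the stack; 2 counts the tree edges, 11 is
-- the cursor, and 1, 3, 4, 5 hold the constants 1, 3, 0, n.
program : Program
program =
  const 1 1 ∷ const 3 3 ∷ load 5 4 ∷ load 12 5 ∷ load 0 12 ∷ add 0 0 12 ∷ add 0 0 1 ∷
  add 6 0 5 ∷ add 7 6 5 ∷ add 8 7 1 ∷ add 9 8 5 ∷ add 9 9 5 ∷ add 10 9 4 ∷
  -- 13: main loop
  jump-if-≡ 10 9 34 ∷
  sub 12 10 1 ∷ load 13 12 ∷ add 14 0 13 ∷ load 15 14 ∷ jump-if-≡ 15 3 38 ∷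
  add 16 13 1 ∷ load 16 16 ∷ load 17 16 ∷ jump-if-≡ 17 4 38 ∷
  add 18 16 17 ∷ load 18 18 ∷ sub 17 17 1 ∷ store 16 17 ∷
  -- 27: visit the vertex in register 18 unless it has been visited
  add 19 6 18 ∷ load 20 19 ∷ jump-if-≡ 20 1 13 ∷
  store 19 1 ∷ store 10 18 ∷ add 10 10 1 ∷ jump 13 ∷
  -- 34: the stack is empty
  jump-if-≡ 11 5 55 ∷ add 18 11 4 ∷ add 11 11 1 ∷ jump 27 ∷
  -- 38: pop
  add 10 12 4 ∷ div 16 15 3 ∷ store 14 16 ∷ jump-if-≡ 15 4 13 ∷ jump-if-≡ 10 9 13 ∷
  -- 43: link the popped vertex to the new top of the stack
  sub 12 10 1 ∷ load 12 12 ∷ store 8 13 ∷ add 8 8 1 ∷ store 8 12 ∷ add 8 8 1 ∷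
  add 14 0 12 ∷ load 16 14 ∷ add 16 16 1 ∷ store 14 16 ∷ add 2 2 1 ∷ jump 13 ∷
  -- 55: output
  store 7 2 ∷ halt ∷ []

module Execution (bits : ℕ) where

  infixr 5 _▸_ _▸▸_

  data Step (s s′ : State) : Set where
    by : step bits program s ≡ just s′ → Step s s′

  data Steps : ℕ → State → State → Set where
    here : ∀ {s} → Steps 0 s s
    _▸_  : ∀ {t s s′ s″} → Step s s′ → Steps t s′ s″ → Steps (suc t) s s″

  _▸▸_ : ∀ {t t′ s s′ s″} → Steps t s s′ → Steps t′ s′ s″ → Steps (t + t′) s s″
  here    ▸▸ q = q
  (e ▸ p) ▸▸ q = e ▸ (p ▸▸ q)

  Steps⇒Run : ∀ {t s s′} → Steps t s s′ → step bits program s′ ≡ nothing → Run bits program t s s′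
  Steps⇒Run here       halted = stop halted
  Steps⇒Run (by e ▸ p) halted = next e (Steps⇒Run p halted)

  fetch : ℕ → Maybe Instr
  fetch p = head (drop p program)

  toWord-small : ∀ {x} → x < 2 ^ bits → toWord bits x ≡ x
  toWord-small = m<n⇒m%n≡m {{m^n≢0 2 bits}}

  step-exec : ∀ s {i} → fetch (pc s) ≡ just i → step bits program s ≡ exec bits i s
  step-exec s eq rewrite eq = refl

  module _ {p : ℕ} {r m : ℕ → ℕ} where

    private
      write : ∀ i d {x y} → fetch p ≡ just i →
              exec bits i ⟨ p , r , m ⟩ ≡ just ⟨ suc p , r [ d ≔ toWord bits x ] , m ⟩ →
              x ≡ y → y < 2 ^ bits → Step ⟨ p , r , m ⟩ ⟨ suc p , r [ d ≔ y ] , m ⟩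
      write i d f e eq y< = by (trans (step-exec ⟨ p , r , m ⟩ f) (trans e
        (cong (λ z → just ⟨ suc p , r [ d ≔ z ] , m ⟩) (trans (cong (toWord bits) eq) (toWord-small y<)))))

    const-step : ∀ {d c} → fetch p ≡ just (const d c) → c < 2 ^ bits →
                 Step ⟨ p , r , m ⟩ ⟨ suc p , r [ d ≔ c ] , m ⟩
    const-step {d} {c} f = write (const d c) d f refl refl

    add-step : ∀ {d a b x} → fetch p ≡ just (add d a b) → r a + r b ≡ x → x < 2 ^ bits →
               Step ⟨ p , r , m ⟩ ⟨ suc p , r [ d ≔ x ] , m ⟩
    add-step {d} {a} {b} f = write (add d a b) d f refl

    sub-step : ∀ {d a b x} → fetch p ≡ just (sub d a b) → r a ∸ r b ≡ x → x < 2 ^ bits →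
               Step ⟨ p , r , m ⟩ ⟨ suc p , r [ d ≔ x ] , m ⟩
    sub-step {d} {a} {b} f = write (sub d a b) d f refl

    div-step : ∀ {d a b x} → fetch p ≡ just (div d a b) → quot (r a) (r b) ≡ x → x < 2 ^ bits →
               Step ⟨ p , r , m ⟩ ⟨ suc p , r [ d ≔ x ] , m ⟩
    div-step {d} {a} {b} f = write (div d a b) d f refl

    load-step : ∀ {d a x} → fetch p ≡ just (load d a) → m (r a) ≡ x → x < 2 ^ bits →
                Step ⟨ p , r , m ⟩ ⟨ suc p , r [ d ≔ x ] , m ⟩
    load-step {d} {a} f = write (load d a) d f refl

    store-step : ∀ {a s x y} → fetch p ≡ just (store a s) → r a ≡ x → r s ≡ y →
                 Step ⟨ p , r , m ⟩ ⟨ suc p , r , m [ x ≔ y ] ⟩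
    store-step f refl refl = by (step-exec ⟨ p , r , m ⟩ f)

    jump-step : ∀ {l} → fetch p ≡ just (jump l) → Step ⟨ p , r , m ⟩ ⟨ l , r , m ⟩
    jump-step f = by (step-exec ⟨ p , r , m ⟩ f)

    branch-step : ∀ {a b l} → fetch p ≡ just (jump-if-≡ a b l) → r a ≡ r b →
                  Step ⟨ p , r , m ⟩ ⟨ l , r , m ⟩
    branch-step {a} {b} {l} f eq = by (trans (step-exec ⟨ p , r , m ⟩ f)
      (cong (λ c → just ⟨ (if c then l else suc p) , r , m ⟩) (dec-true (r a Nat.≟ r b) eq)))

    fall-step : ∀ {a b l} → fetch p ≡ just (jump-if-≡ a b l) → r a ≢ r b →
                Step ⟨ p , r , m ⟩ ⟨ suc p , r , m ⟩
    fall-step {a} {b} {l} f neq = by (trans (step-exec ⟨ p , r , m ⟩ f)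
      (cong (λ c → just ⟨ (if c then l else suc p) , r , m ⟩) (dec-false (r a Nat.≟ r b) neq)))

mark : Status → ℕ
mark new = 0
mark _   = 1

mark-visited : ∀ {s} → s ≢ new → mark s ≡ 1
mark-visited {new}    s≢new = contradiction refl s≢new
mark-visited {active} _     = refl
mark-visited {done}   _     = refl

flatten : List (Fin n × Fin n) → List ℕ
flatten = concatMap (λ (u , v) → toℕ u ∷ toℕ v ∷ [])

length-flatten : (es : List (Fin n × Fin n)) → length (flatten es) ≡ length es + length es
length-flatten []       = refl
length-flatten (e ∷ es) =
  cong suc (trans (cong suc (length-flatten es)) (sym (+-suc (length es) (length es))))

-- The memory of the machine

module Layout {n : ℕ} {G : Graph n} (L : AdjacencyLists G) (U : Subset n) where
  open AdjacencyLists L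
  open DepthFirst L U
  open Config

  hdr : Fin n → ℕ
  hdr = blockStart (suc n) nbrs

  valBase markBase edgeBase stackBase limit : ℕ
  valBase   = suc n + blocksLength nbrs
  markBase  = valBase + n
  edgeBase  = markBase + n
  stackBase = edgeBase + 1 + n + n
  limit     = stackBase + n

  Stacked : (ℕ → ℕ) → List (Fin n) → Set
  Stacked m []      = Unit
  Stacked m (v ∷ s) = m (stackBase + length s) ≡ toℕ v × Stacked m s

  record Memory (m : ℕ → ℕ) (σ : Config) : Set where
    field
      ptrs    : ∀ v → m (suc (toℕ v)) ≡ hdr v
      rems    : ∀ v → m (hdr v) ≡ rem σ v
      adjs    : ∀ v j → m (hdr v + suc (toℕ j)) ≡ toℕ (lookup (nbrs v) j)
      vals    : ∀ v → m (valBase + toℕ v) ≡ val σ v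
      marks   : ∀ v → m (markBase + toℕ v) ≡ mark (status σ v)
      edges   : StoredAt m (edgeBase + 1) (flatten (tree σ))
      stacked : Stacked m (stack σ)

  open Memory

  valBase≤markBase : valBase ≤ markBase
  valBase≤markBase = m≤m+n valBase n

  markBase≤edgeBase : markBase ≤ edgeBase
  markBase≤edgeBase = m≤m+n markBase n

  edgeBase<stackBase : edgeBase < stackBase
  edgeBase<stackBase = ≤-trans (≤-reflexive (+-comm 1 edgeBase)) (≤-trans (m≤m+n (edgeBase + 1) n) (m≤m+n _ n))

  stackBase≤limit : stackBase ≤ limit
  stackBase≤limit = m≤m+n stackBase n

  hdr>n : ∀ v → n < hdr v
  hdr>n v = blockStart-≥ (suc n) nbrs v

  entry<valBase : ∀ v {i} → i ≤ length (nbrs v) → hdr v + i < valBase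
  entry<valBase v i≤ = <-≤-trans (+-monoʳ-< (hdr v) (s≤s i≤)) (blockStart-end (suc n) nbrs v)

  hdr<valBase : ∀ v → hdr v < valBase
  hdr<valBase v = subst (_< valBase) (+-identityʳ (hdr v)) (entry<valBase v z≤n)

  n<valBase : n < valBase
  n<valBase = m≤m+n (suc n) (blocksLength nbrs)

  below : ∀ b (v : Fin n) → b + toℕ v < b + n
  below b v = +-monoʳ-< b (toℕ<n v)

  module _ (m : ℕ → ℕ) {a x : ℕ} where

    keep-ptrs : n < a → (∀ v → m (suc (toℕ v)) ≡ hdr v) →
                ∀ v → (m [ a ≔ x ]) (suc (toℕ v)) ≡ hdr v
    keep-ptrs n<a h v = trans (≔-minimal m (<⇒≢ (≤-<-trans (toℕ<n v) n<a))) (h v)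

    keep-rems : ∀ {f : Fin n → ℕ} → valBase ≤ a → (∀ v → m (hdr v) ≡ f v) →
                ∀ v → (m [ a ≔ x ]) (hdr v) ≡ f v
    keep-rems ≤a h v = trans (≔-minimal m (<⇒≢ (<-≤-trans (hdr<valBase v) ≤a))) (h v)

    keep-adjs : valBase ≤ a → (∀ v j → m (hdr v + suc (toℕ j)) ≡ toℕ (lookup (nbrs v) j)) →
                ∀ v j → (m [ a ≔ x ]) (hdr v + suc (toℕ j)) ≡ toℕ (lookup (nbrs v) j)
    keep-adjs ≤a h v j = trans (≔-minimal m (<⇒≢ (<-≤-trans (entry<valBase v (toℕ<n j)) ≤a))) (h v j)

    keep-array : ∀ b {f : Fin n → ℕ} → a < b ⊎ b + n ≤ a → (∀ v → m (b + toℕ v) ≡ f v) →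
                 ∀ v → (m [ a ≔ x ]) (b + toℕ v) ≡ f v
    keep-array b out h v = trans (≔-minimal m (Sum.[
      (λ a<b → >⇒≢ (<-≤-trans a<b (m≤m+n b (toℕ v)))) ,
      (λ ≤a → <⇒≢ (<-≤-trans (below b v) ≤a)) ]′ out)) (h v)

    keep-stored : ∀ b xs → a < b ⊎ b + length xs ≤ a → StoredAt m b xs → StoredAt (m [ a ≔ x ]) b xs
    keep-stored b xs out = StoredAt-cong xs λ c b≤c c< → ≔-minimal m (Sum.[
      (λ a<b → >⇒≢ (<-≤-trans a<b b≤c)) ,
      (λ ≤a → <⇒≢ (<-≤-trans c< ≤a)) ]′ out)

    keep-stacked : ∀ s → a < stackBase ⊎ stackBase + length s ≤ a →
                   Stacked m s → Stacked (m [ a ≔ x ]) s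
    keep-stacked []      _   _       = tt
    keep-stacked (v ∷ s) out (e , h) =
      trans (≔-minimal m (Sum.[
        (λ a< → >⇒≢ (<-≤-trans a< (m≤m+n stackBase (length s)))) ,
        (λ ≤a → <⇒≢ (<-≤-trans (+-monoʳ-< stackBase ≤-refl) ≤a)) ]′ out)) e ,
      keep-stacked s (Sum.map₂ (≤-trans (+-monoʳ-≤ stackBase (n≤1+n _))) out) h

  update-array : ∀ m b (f : Fin n → ℕ) v {x} → (∀ w → m (b + toℕ w) ≡ f w) →
                 ∀ w → (m [ b + toℕ v ≔ x ]) (b + toℕ w) ≡ (f ⟨ v ≔ x ⟩) w
  update-array m b f v h w = ⟨≔⟩-elim (λ y → (m [ b + toℕ v ≔ _ ]) (b + toℕ w) ≡ y) {f} v w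
    (λ { refl → ≔-updates m (b + toℕ v) })
    (λ w≢v → trans (≔-minimal m (w≢v ∘ toℕ-injective ∘ +-cancelˡ-≡ b _ _)) (h w))

  scan-memory : ∀ {m σ} v j → Memory m σ → Memory (m [ hdr v ≔ j ]) (scan v j σ)
  scan-memory {m} {σ} v j M = record
    { ptrs    = keep-ptrs m (hdr>n v) (ptrs M)
    ; rems    = λ w → ⟨≔⟩-elim (λ y → (m [ hdr v ≔ j ]) (hdr w) ≡ y) {rem σ} v w
        (λ { refl → ≔-updates m (hdr v) })
        (λ w≢v → trans (≔-minimal m (λ eq → blockStart-disjoint (suc n) nbrs w≢v z≤n z≤n (cong (_+ 0) eq)))
                       (rems M w))
    ; adjs    = λ w i → trans (≔-minimal m (λ eq → differ w i eq (w ≟ v))) (adjs M w i)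
    ; vals    = keep-array m valBase (inj₁ (hdr<valBase v)) (vals M)
    ; marks   = keep-array m markBase (inj₁ (<-≤-trans (hdr<valBase v) valBase≤markBase)) (marks M)
    ; edges   = keep-stored m (edgeBase + 1) _ (inj₁ (<-≤-trans hdr<edgeBase (m≤m+n edgeBase 1))) (edges M)
    ; stacked = keep-stacked m _ (inj₁ (<-trans hdr<edgeBase edgeBase<stackBase)) (stacked M) }
    where
    hdr<edgeBase : hdr v < edgeBase
    hdr<edgeBase = <-≤-trans (hdr<valBase v) (≤-trans valBase≤markBase markBase≤edgeBase)
    differ : ∀ w (i : Fin (length (nbrs w))) → hdr w + suc (toℕ i) ≡ hdr v → ¬ Dec (w ≡ v)
    differ w i eq (yes refl) = m+1+n≢m (hdr v) eq
    differ w i eq (no w≢v)   = blockStart-disjoint (suc n) nbrs w≢v (toℕ<n i) z≤n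
      (trans eq (sym (+-identityʳ (hdr v))))

  tree-length≤ : ∀ {σ} → Core σ → length (tree σ) ≤ n
  tree-length≤ {σ} C = subst (_≤ n) (length-map proj₁ (tree σ))
    (Unique⇒length-≤ (AllPairs.map⁺ (AllPairs.map proj₁ (Core.tree-leaf C))))

  edgesEnd : List (Fin n × Fin n) → ℕ
  edgesEnd es = edgeBase + 1 + length (flatten es)

  edgesEnd-∷ʳ : ∀ es e → edgesEnd (es ∷ʳ e) ≡ edgesEnd es + 1 + 1
  edgesEnd-∷ʳ es e = begin
    edgeBase + 1 + length (flatten (es ∷ʳ e))
      ≡⟨ cong (λ l → edgeBase + 1 + length l) (concatMap-++ _ es (e ∷ [])) ⟩
    edgeBase + 1 + length (flatten es ++ flatten (e ∷ []))
      ≡⟨ cong (edgeBase + 1 +_) (length-++ (flatten es)) ⟩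
    edgeBase + 1 + (length (flatten es) + 2)
      ≡⟨ +-assoc (edgeBase + 1) _ 2 ⟨
    edgesEnd es + 2
      ≡⟨ +-assoc (edgesEnd es) 1 1 ⟨
    edgesEnd es + 1 + 1 ∎
    where open ≡-Reasoning

  edgesEnd≤stackBase : ∀ es → length es ≤ n → edgesEnd es ≤ stackBase
  edgesEnd≤stackBase es ≤n = begin
    edgesEnd es                                ≡⟨ cong (edgeBase + 1 +_) (length-flatten es) ⟩
    edgeBase + 1 + (length es + length es)     ≤⟨ +-monoʳ-≤ (edgeBase + 1) (+-mono-≤ ≤n ≤n) ⟩
    edgeBase + 1 + (n + n)                     ≡⟨ +-assoc (edgeBase + 1) n n ⟨
    stackBase                                  ∎
    where open ≤-Reasoning

  edgeBase<edgesEnd : ∀ es → edgeBase < edgesEnd es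
  edgeBase<edgesEnd es = ≤-trans (≤-reflexive (+-comm 1 edgeBase)) (m≤m+n (edgeBase + 1) _)

  visit-memory : ∀ {m σ} x r c → length (tree σ) ≤ n → Memory m σ →
    Memory (m [ markBase + toℕ x ≔ 1 ] [ stackBase + length (stack σ) ≔ toℕ x ]) (visit x r c σ)
  visit-memory {m} {σ} x r c tree≤n M = record
    { ptrs    = keep-ptrs m₁ n<a′ (keep-ptrs m n<a (ptrs M))
    ; rems    = keep-rems m₁ ≤a′ (keep-rems m ≤a (rems M))
    ; adjs    = keep-adjs m₁ ≤a′ (keep-adjs m ≤a (adjs M))
    ; vals    = keep-array m₁ valBase (inj₂ (≤-trans markBase≤edgeBase edgeBase≤a′))
                  (keep-array m valBase (inj₂ (m≤m+n markBase _)) (vals M))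
    ; marks   = keep-array m₁ markBase (inj₂ edgeBase≤a′) λ v → trans
                  (update-array m markBase (mark ∘ status σ) x (marks M) v) (mark-updated v)
    ; edges   = keep-stored m₁ (edgeBase + 1) (flatten (tree σ)) (inj₂ edges≤a′)
                  (keep-stored m (edgeBase + 1) (flatten (tree σ))
                    (inj₁ (<-≤-trans a<edgeBase (m≤m+n edgeBase 1))) (edges M))
    ; stacked = ≔-updates m₁ (stackBase + length (stack σ)) , keep-stacked m₁ _ (inj₂ ≤-refl)
                  (keep-stacked m _ (inj₁ (<-trans a<edgeBase edgeBase<stackBase)) (stacked M)) }
    where
    m₁ = m [ markBase + toℕ x ≔ 1 ]
    ≤a : valBase ≤ markBase + toℕ x
    ≤a = ≤-trans valBase≤markBase (m≤m+n markBase _)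
    n<a = <-≤-trans n<valBase ≤a
    a<edgeBase : markBase + toℕ x < edgeBase
    a<edgeBase = below markBase x
    edgeBase≤a′ : edgeBase ≤ stackBase + length (stack σ)
    edgeBase≤a′ = ≤-trans (<⇒≤ edgeBase<stackBase) (m≤m+n stackBase _)
    edges≤a′ = ≤-trans (edgesEnd≤stackBase (tree σ) tree≤n) (m≤m+n stackBase (length (stack σ)))
    ≤a′ : valBase ≤ stackBase + length (stack σ)
    ≤a′ = ≤-trans valBase≤markBase (≤-trans markBase≤edgeBase edgeBase≤a′)
    n<a′ = <-≤-trans n<valBase ≤a′
    mark-updated : ∀ v → ((mark ∘ status σ) ⟨ x ≔ 1 ⟩) v ≡ mark ((status σ ⟨ x ≔ active ⟩) v)
    mark-updated v with v ≟ x
    ... | yes _ = refl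
    ... | no  _ = refl

  finish-memory : ∀ {m σ} v s → stack σ ≡ v ∷ s → status σ v ≡ active → Memory m σ →
    Memory (m [ valBase + toℕ v ≔ val σ v / 3 ]) (finish v s σ)
  finish-memory {m} {σ} v s stack≡ v-active M = record
    { ptrs    = keep-ptrs m (<-≤-trans n<valBase (m≤m+n valBase _)) (ptrs M)
    ; rems    = keep-rems m (m≤m+n valBase _) (rems M)
    ; adjs    = keep-adjs m (m≤m+n valBase _) (adjs M)
    ; vals    = update-array m valBase (val σ) v (vals M)
    ; marks   = λ w → trans (keep-array m markBase (inj₁ (below valBase v)) (marks M) w) (mark-kept w)
    ; edges   = keep-stored m (edgeBase + 1) (flatten (tree σ))
                  (inj₁ (<-≤-trans a<edgeBase (m≤m+n edgeBase 1))) (edges M)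
    ; stacked = keep-stacked m s (inj₁ (<-trans a<edgeBase edgeBase<stackBase))
                  (proj₂ (subst (Stacked m) stack≡ (stacked M))) }
    where
    a<edgeBase : valBase + toℕ v < edgeBase
    a<edgeBase = <-≤-trans (below valBase v) markBase≤edgeBase
    mark-kept : ∀ w → mark (status σ w) ≡ mark ((status σ ⟨ v ≔ done ⟩) w)
    mark-kept w = ⟨≔⟩-elim (λ t → mark (status σ w) ≡ mark t) {status σ} v w
      (λ { refl → cong mark v-active }) (λ _ → refl)

  module _ {m σ} (M : Memory m σ) (v p : Fin n) where
    private
      E  = edgesEnd (tree σ)
      m₁ = m [ E ≔ toℕ v ]
      m₂ = m₁ [ E + 1 ≔ toℕ p ]
      a  = valBase + toℕ p

      edgeBase<E : edgeBase < E
      edgeBase<E = edgeBase<edgesEnd (tree σ)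
      edgeBase<E+1 : edgeBase < E + 1
      edgeBase<E+1 = <-≤-trans edgeBase<E (m≤m+n E 1)
      markBase≤E : markBase ≤ E
      markBase≤E = ≤-trans markBase≤edgeBase (<⇒≤ edgeBase<E)
      markBase≤E+1 : markBase ≤ E + 1
      markBase≤E+1 = ≤-trans markBase≤E (m≤m+n E 1)
      a<edgeBase : a < edgeBase
      a<edgeBase = <-≤-trans (below valBase p) markBase≤edgeBase

    edge-vals : ∀ w → m₂ (valBase + toℕ w) ≡ val σ w
    edge-vals = keep-array m₁ valBase (inj₂ markBase≤E+1) (keep-array m valBase (inj₂ markBase≤E) (vals M))

    link-memory : length (tree σ ∷ʳ (v , p)) ≤ n →
                  Memory (m₂ [ a ≔ suc (val σ p) ]) (link v p σ)
    link-memory ≤n = record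
      { ptrs    = keep-ptrs m₂ (n< (m≤m+n valBase _))
                    (keep-ptrs m₁ (n< ≤E+1) (keep-ptrs m (n< ≤E) (ptrs M)))
      ; rems    = keep-rems m₂ (m≤m+n valBase _) (keep-rems m₁ ≤E+1 (keep-rems m ≤E (rems M)))
      ; adjs    = keep-adjs m₂ (m≤m+n valBase _) (keep-adjs m₁ ≤E+1 (keep-adjs m ≤E (adjs M)))
      ; vals    = update-array m₂ valBase (val σ) p edge-vals
      ; marks   = keep-array m₂ markBase (inj₁ (below valBase p))
                    (keep-array m₁ markBase (inj₂ (<⇒≤ edgeBase<E+1))
                      (keep-array m markBase (inj₂ (<⇒≤ edgeBase<E)) (marks M)))
      ; edges   = keep-stored m₂ (edgeBase + 1) (flatten (tree σ ∷ʳ (v , p)))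
                    (inj₁ (<-≤-trans a<edgeBase (m≤m+n edgeBase 1)))
                    (subst (StoredAt m₂ (edgeBase + 1)) (sym (concatMap-++ _ (tree σ) ((v , p) ∷ [])))
                      (StoredAt-++⁺ (flatten (tree σ))
                        (keep-stored m₁ (edgeBase + 1) (flatten (tree σ)) (inj₂ (m≤m+n E 1))
                          (keep-stored m (edgeBase + 1) (flatten (tree σ)) (inj₂ ≤-refl) (edges M)))
                        ( trans (≔-minimal m₁ (<⇒≢ E<E+1)) (≔-updates m E)
                        , trans (cong m₂ (+-comm 1 E)) (≔-updates m₁ (E + 1)) , tt)))
      ; stacked = keep-stacked m₂ (stack σ) (inj₁ (<-trans a<edgeBase edgeBase<stackBase))
                    (keep-stacked m₁ (stack σ) (inj₁ E+1<stackBase)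
                      (keep-stacked m (stack σ) (inj₁ (<-trans E<E+1 E+1<stackBase)) (stacked M))) }
      where
      ≤E : valBase ≤ E
      ≤E = ≤-trans valBase≤markBase markBase≤E
      ≤E+1 : valBase ≤ E + 1
      ≤E+1 = ≤-trans valBase≤markBase markBase≤E+1
      n< : ∀ {b} → valBase ≤ b → n < b
      n< = <-≤-trans n<valBase
      E<E+1 : E < E + 1
      E<E+1 = ≤-reflexive (+-comm 1 E)
      E+1<stackBase : E + 1 < stackBase
      E+1<stackBase = ≤-trans (≤-reflexive (trans (+-comm 1 (E + 1)) (sym (edgesEnd-∷ʳ (tree σ) (v , p)))))
                              (edgesEnd≤stackBase (tree σ ∷ʳ (v , p)) ≤n)

-- Running the program

module Simulation {n : ℕ} {G : Graph n} (L : AdjacencyLists G) (U : Subset n) (bits : ℕ)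
                  (limit<2^bits : Layout.limit L U < 2 ^ bits) (3<2^bits : 3 < 2 ^ bits) where
  open AdjacencyLists L
  open DepthFirst L U
  open Config
  open Layout L U
  open Memory
  open Execution bits
  open Inv
  open Core

  record Registers (r : ℕ → ℕ) (σ : Config) : Set where
    field
      r0≡  : r 0  ≡ valBase
      r1≡  : r 1  ≡ 1
      r2≡  : r 2  ≡ length (tree σ)
      r3≡  : r 3  ≡ 3
      r4≡  : r 4  ≡ 0
      r5≡  : r 5  ≡ n
      r6≡  : r 6  ≡ markBase
      r7≡  : r 7  ≡ edgeBase
      r8≡  : r 8  ≡ edgesEnd (tree σ)
      r9≡  : r 9  ≡ stackBase
      r10≡ : r 10 ≡ stackBase + length (stack σ)
      r11≡ : r 11 ≡ cursor σ

  open Registers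

  record Progress (σ : Config) (p : ℕ) (r m : ℕ → ℕ) (b : ℕ) : Set where
    field
      {time}    : ℕ
      {σ′}      : Config
      {r′ m′}   : ℕ → ℕ
      time≤     : time ≤ b
      steps     : Steps time ⟨ p , r , m ⟩ ⟨ 13 , r′ , m′ ⟩
      inv       : Inv σ′
      registers : Registers r′ σ′
      memory    : Memory m′ σ′
      decrease  : μ σ′ < μ σ

  after : ∀ {σ t b p p′ r r′ m m′} → Steps t ⟨ p , r , m ⟩ ⟨ p′ , r′ , m′ ⟩ →
          Progress σ p′ r′ m′ b → Progress σ p r m (t + b)
  after {t = t} S P = record
    { time≤ = +-monoʳ-≤ t (Progress.time≤ P) ; steps = S ▸▸ Progress.steps P
    ; inv = Progress.inv P ; registers = Progress.registers P ; memory = Progress.memory P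
    ; decrease = Progress.decrease P }

  weaken-bound : ∀ {σ b b′ p r m} → b ≤ b′ → Progress σ p r m b → Progress σ p r m b′
  weaken-bound b≤ P = record { Progress P ; time≤ = ≤-trans (Progress.time≤ P) b≤ }

  small : ∀ {x} → x ≤ limit → x < 2 ^ bits
  small x≤ = ≤-<-trans x≤ limit<2^bits

  small₃ : ∀ {x} → x ≤ 3 → x < 2 ^ bits
  small₃ x≤ = ≤-<-trans x≤ 3<2^bits

  ≤stackBase : ∀ {x} → x ≤ stackBase → x < 2 ^ bits
  ≤stackBase x≤ = small (≤-trans x≤ stackBase≤limit)

  ≤edgeBase : ∀ {x} → x ≤ edgeBase → x < 2 ^ bits
  ≤edgeBase x≤ = ≤stackBase (≤-trans x≤ (<⇒≤ edgeBase<stackBase))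

  ≤markBase : ∀ {x} → x ≤ markBase → x < 2 ^ bits
  ≤markBase x≤ = ≤edgeBase (≤-trans x≤ markBase≤edgeBase)

  ≤valBase : ∀ {x} → x ≤ valBase → x < 2 ^ bits
  ≤valBase x≤ = ≤markBase (≤-trans x≤ valBase≤markBase)

  ≤n : ∀ {x} → x ≤ n → x < 2 ^ bits
  ≤n x≤ = ≤valBase (≤-trans x≤ (<⇒≤ n<valBase))

  vertex-small : (v : Fin n) → toℕ v < 2 ^ bits
  vertex-small v = ≤n (<⇒≤ (toℕ<n v))

  val-small : (v : Fin n) → valBase + toℕ v < 2 ^ bits
  val-small v = ≤markBase (<⇒≤ (below valBase v))

  mark-small : (v : Fin n) → markBase + toℕ v < 2 ^ bits
  mark-small v = ≤edgeBase (<⇒≤ (below markBase v))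

  one-small : 1 < 2 ^ bits
  one-small = small₃ (s≤s z≤n)

  stack-small : ∀ {k} → k ≤ n → stackBase + k < 2 ^ bits
  stack-small k≤n = small (+-monoʳ-≤ stackBase k≤n)

  pop-top : ∀ {x l} → x ≡ stackBase + suc l → x ∸ 1 ≡ stackBase + l
  pop-top {l = l} eq = cong (_∸ 1) (trans eq (+-suc stackBase l))

  module _ {σ r m} (R : Registers r σ) (M : Memory m σ) (x : Fin n) (r18≡ : r 18 ≡ toℕ x) where

    visited-steps : status σ x ≢ new →
      ∃ λ r′ → Steps 3 ⟨ 27 , r , m ⟩ ⟨ 13 , r′ , m ⟩ × Registers r′ σ
    visited-steps x≢new = _ ,
      ( add-step refl (cong₂ _+_ (r6≡ R) r18≡) (mark-small x)
      ▸ load-step refl (trans (marks M x) (mark-visited x≢new)) one-small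
      ▸ branch-step refl (sym (r1≡ R))
      ▸ here) , record { Registers R }

    visit-steps : ∀ y → status σ x ≡ new → suc (length (stack σ)) ≤ n → length (tree σ) ≤ n →
      ∃₂ λ r′ m′ → Steps 7 ⟨ 27 , r , m ⟩ ⟨ 13 , r′ , m′ ⟩ ×
        Registers r′ (visit x y (cursor σ) σ) × Memory m′ (visit x y (cursor σ) σ)
    visit-steps y x-new stack<n tree≤n = _ , _ ,
      ( add-step refl (cong₂ _+_ (r6≡ R) r18≡) (mark-small x)
      ▸ load-step refl (trans (marks M x) (cong mark x-new)) (small₃ z≤n)
      ▸ fall-step refl (λ eq → 0≢1+n (trans eq (r1≡ R)))
      ▸ store-step refl refl (r1≡ R)
      ▸ store-step refl (r10≡ R) r18≡
      ▸ add-step refl (trans (cong₂ _+_ (r10≡ R) (r1≡ R))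
          (trans (+-assoc stackBase _ 1) (cong (stackBase +_) (+-comm _ 1)))) (stack-small stack<n)
      ▸ jump-step refl
      ▸ here) , record { Registers R ; r10≡ = refl } , visit-memory x y (cursor σ) tree≤n M

  module Pop {σ r m} (I : Inv σ) (R : Registers r σ) (M : Memory m σ)
             (v : Fin n) (s : List (Fin n)) (stack≡ : stack σ ≡ v ∷ s)
             (full : val σ v ≡ 3 ⊎ rem σ v ≡ 0)
             (r12≡ : r 12 ≡ stackBase + length s) (r13≡ : r 13 ≡ toℕ v)
             (r14≡ : r 14 ≡ valBase + toℕ v) (r15≡ : r 15 ≡ val σ v) where

    v∈stack : v ∈ stack σ
    v∈stack = subst (v ∈_) (sym stack≡) (here refl)

    v-active : status σ v ≡ active
    v-active = stack⇒active (core I) v∈stack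

    s≤n : length s ≤ n
    s≤n = <⇒≤ (Unique⇒length-≤ (subst Unique stack≡ (stack-unique (core I))))

    m₁ : ℕ → ℕ
    m₁ = m [ valBase + toℕ v ≔ val σ v / 3 ]

    r₁ : ℕ → ℕ
    r₁ = r [ 10 ≔ stackBase + length s ] [ 16 ≔ val σ v / 3 ]

    R₁ : Registers r₁ (finish v s σ)
    R₁ = record { Registers R ; r10≡ = refl }

    M₁ : Memory m₁ (finish v s σ)
    M₁ = finish-memory v s stack≡ v-active M

    finish-steps : Steps 3 ⟨ 38 , r , m ⟩ ⟨ 41 , r₁ , m₁ ⟩
    finish-steps =
        add-step refl (trans (cong₂ _+_ r12≡ (r4≡ R)) (+-identityʳ _)) (stack-small s≤n)
      ▸ div-step refl (cong₂ quot r15≡ (r3≡ R)) (small₃ (≤-trans (m/n≤m (val σ v) 3) (stack-val (core I) v∈stack)))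
      ▸ store-step refl r14≡ refl
      ▸ here

    unlinked : ∀ {t} → Steps t ⟨ 38 , r , m ⟩ ⟨ 13 , r₁ , m₁ ⟩ → val σ v ≡ 0 ⊎ s ≡ [] →
               Progress σ 38 r m t
    unlinked S u = record
      { time≤ = ≤-refl ; steps = S ; inv = finish-inv I v s stack≡ full u
      ; registers = R₁ ; memory = M₁ ; decrease = finish-μ σ v s v-active }

    linked : ∀ p s′ → s ≡ p ∷ s′ → val σ v ≢ 0 → Progress σ 38 r m 17
    linked p s′ refl val≢0 = record
      { time≤ = ≤-refl
      ; steps = finish-steps ▸▸
          ( fall-step refl (λ eq → val≢0 (trans (sym r15≡) (trans eq (r4≡ R))))
          ▸ fall-step refl (λ eq → m+1+n≢m stackBase (trans eq (r9≡ R)))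
          ▸ sub-step refl (trans (cong (stackBase + length s ∸_) (r1≡ R)) (pop-top refl))
              (stack-small (≤-trans (n≤1+n _) s≤n))
          ▸ load-step refl (proj₁ (stacked M₁)) (vertex-small p)
          ▸ store-step refl (r8≡ R) r13≡
          ▸ add-step refl (cong₂ _+_ (r8≡ R) (r1≡ R)) (≤stackBase (≤-trans (m≤m+n _ 1) E+2≤))
          ▸ store-step refl refl refl
          ▸ add-step refl (cong (edgesEnd (tree σ) + 1 +_) (r1≡ R)) (≤stackBase E+2≤)
          ▸ add-step refl (cong₂ _+_ (r0≡ R) refl) (val-small p)
          ▸ load-step refl (edge-vals M₁ v p p) (≤-<-trans (n≤1+n _) (small₃ val-p≤3))
          ▸ add-step refl (trans (cong (val τ p +_) (r1≡ R)) (+-comm _ 1)) (small₃ val-p≤3)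
          ▸ store-step refl refl refl
          ▸ add-step refl (trans (cong₂ _+_ (r2≡ R) (r1≡ R)) (sym (length-++ (tree σ))))
              (≤n tree≤n)
          ▸ jump-step refl
          ▸ here)
      ; inv = I′
      ; registers = record { Registers R₁ ; r2≡ = refl ; r8≡ = sym (edgesEnd-∷ʳ (tree σ) (v , p)) }
      ; memory = link-memory M₁ v p tree≤n
      ; decrease = finish-μ σ v s v-active }
      where
      τ = finish v s σ
      I′ : Inv (link v p τ)
      I′ = link-inv I v s stack≡ full p s′ refl (n≢0⇒n>0 val≢0)
      tree≤n : length (tree σ ∷ʳ (v , p)) ≤ n
      tree≤n = tree-length≤ (core I′)
      E+2≤ : edgesEnd (tree σ) + 1 + 1 ≤ stackBase
      E+2≤ = subst (_≤ stackBase) (edgesEnd-∷ʳ (tree σ) (v , p)) (edgesEnd≤stackBase (tree σ ∷ʳ (v , p)) tree≤n)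
      val-p≤3 : suc (val τ p) ≤ 3
      val-p≤3 = subst (_≤ 3) (⟨≔⟩-updates (val τ) p) (stack-val (core I′) (here refl))

    popped : Progress σ 38 r m 17
    popped with val σ v Nat.≟ 0
    ... | yes val≡0 = weaken-bound (≤ᵇ⇒≤ 4 17 tt)
      (unlinked (finish-steps ▸▸ branch-step refl (trans r15≡ (trans val≡0 (sym (r4≡ R)))) ▸ here) (inj₁ val≡0))
    ... | no val≢0 = by-rest s refl
      where
      by-rest : ∀ l → s ≡ l → Progress σ 38 r m 17
      by-rest []       refl = weaken-bound (≤ᵇ⇒≤ 5 17 tt) (unlinked (finish-steps ▸▸
          ( fall-step refl (λ eq → val≢0 (trans (sym r15≡) (trans eq (r4≡ R))))
          ▸ branch-step refl (trans (+-identityʳ stackBase) (sym (r9≡ R)))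
          ▸ here)) (inj₂ refl))
      by-rest (p ∷ s′) s≡   = linked p s′ s≡ val≢0

  new? : ∀ s → s ≡ new ⊎ s ≢ new
  new? new    = inj₁ refl
  new? active = inj₂ λ ()
  new? done   = inj₂ λ ()

  module _ {σ r m} (I : Inv σ) (R : Registers r σ) (M : Memory m σ) where
    private
      C = core I

    from-root : stack σ ≡ [] → cursor σ < n → Progress σ 13 r m 12
    from-root empty c<n = after root-steps (visit-root (new? (status σ x)))
      where
      x : Fin n
      x = fromℕ< c<n
      x≡ : toℕ x ≡ cursor σ
      x≡ = toℕ-fromℕ< c<n
      r₁ = r [ 18 ≔ toℕ x ] [ 11 ≔ suc (cursor σ) ]
      root-steps : Steps 5 ⟨ 13 , r , m ⟩ ⟨ 27 , r₁ , m ⟩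
      root-steps =
          branch-step refl (trans (r10≡ R) (trans (cong (λ l → stackBase + length l) empty)
            (trans (+-identityʳ stackBase) (sym (r9≡ R)))))
        ▸ fall-step refl (λ eq → <⇒≢ c<n (trans (sym (r11≡ R)) (trans eq (r5≡ R))))
        ▸ add-step refl (trans (cong₂ _+_ (r11≡ R) (r4≡ R)) (trans (+-identityʳ _) (sym x≡))) (vertex-small x)
        ▸ add-step refl (trans (cong₂ _+_ (r11≡ R) (r1≡ R)) (+-comm _ 1)) (≤n c<n)
        ▸ jump-step refl
        ▸ here
      R₁ : Registers r₁ (skip σ)
      R₁ = record { Registers R ; r11≡ = refl }
      M₁ : Memory m (skip σ)
      M₁ = record { Memory M }
      visit-root : status σ x ≡ new ⊎ status σ x ≢ new → Progress σ 27 r₁ m 7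
      visit-root (inj₂ x≢new) =
        let r′ , S , R′ = visited-steps R₁ M₁ x refl x≢new
        in record
          { time≤ = ≤ᵇ⇒≤ 3 7 tt ; steps = S
          ; inv = skip-inv I empty c<n λ v v≡ →
              subst (λ w → status σ w ≢ new) (toℕ-injective (trans x≡ (sym v≡))) x≢new
          ; registers = R′ ; memory = M₁ ; decrease = skip-μ σ c<n }
      visit-root (inj₁ x-new) =
        let r′ , m′ , S , R′ , M′ = visit-steps R₁ M₁ x refl x x-new
              (subst (λ l → suc (length l) ≤ n) (sym empty) (≤-trans (s≤s z≤n) c<n)) (tree-length≤ C)
        in record
          { time≤ = ≤-refl ; steps = S
          ; inv = visit-inv I x x (suc (cursor σ)) x-new c<n (n≤1+n _)
              (λ v v<sc → Sum.[ inj₂ , (λ v≡ → inj₁ (toℕ-injective (trans v≡ (sym x≡)))) ]′ (m≤n⇒m<n∨m≡n (s≤s⁻¹ v<sc)))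
              (cong suc x≡)
              (λ v∈ → contradiction (subst (_ ∈_) empty v∈) λ ())
              (subst (λ l → Linked _ (x ∷ l)) (sym empty) [-])
              (subst (λ l → Bottom _ (x ∷ l)) (sym empty) (cong suc x≡))
              (subst (All _) (sym empty) [])
          ; registers = R′ ; memory = M′ ; decrease = visit-μ σ x x x-new (n≤1+n _) }

    module Top (v : Fin n) (s : List (Fin n)) (stack≡ : stack σ ≡ v ∷ s) where

      v∈stack : v ∈ stack σ
      v∈stack = subst (v ∈_) (sym stack≡) (here refl)

      v-active : status σ v ≡ active
      v-active = stack⇒active C v∈stack

      s≤n : suc (length s) ≤ n
      s≤n = Unique⇒length-≤ (subst Unique stack≡ (stack-unique C))

      r₁ : ℕ → ℕ
      r₁ = r [ 12 ≔ stackBase + length s ] [ 13 ≔ toℕ v ] [ 14 ≔ valBase + toℕ v ] [ 15 ≔ val σ v ]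

      r10-top : r 10 ≡ stackBase + suc (length s)
      r10-top = trans (r10≡ R) (cong (λ l → stackBase + length l) stack≡)

      top-steps : Steps 5 ⟨ 13 , r , m ⟩ ⟨ 18 , r₁ , m ⟩
      top-steps =
          fall-step refl (λ eq → m+1+n≢m stackBase (trans (sym r10-top) (trans eq (r9≡ R))))
        ▸ sub-step refl (trans (cong₂ _∸_ r10-top (r1≡ R)) (pop-top refl)) (stack-small (<⇒≤ s≤n))
        ▸ load-step refl (proj₁ (subst (Stacked m) stack≡ (stacked M))) (vertex-small v)
        ▸ add-step refl (cong₂ _+_ (r0≡ R) refl) (val-small v)
        ▸ load-step refl (vals M v) (small₃ (stack-val C v∈stack))
        ▸ here

      r₂ : ℕ → ℕ
      r₂ = r₁ [ 16 ≔ suc (toℕ v) ] [ 16 ≔ hdr v ] [ 17 ≔ rem σ v ]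

      rem-small : rem σ v < 2 ^ bits
      rem-small = ≤valBase (≤-trans (rem≤ C v) (≤-trans (m≤n+m _ (hdr v)) (<⇒≤ (entry<valBase v ≤-refl))))

      rem-steps : val σ v ≢ 3 → Steps 4 ⟨ 18 , r₁ , m ⟩ ⟨ 22 , r₂ , m ⟩
      rem-steps val≢3 =
          fall-step refl (λ eq → val≢3 (trans eq (r3≡ R)))
        ▸ add-step refl (trans (cong (toℕ v +_) (r1≡ R)) (+-comm _ 1)) (≤n (toℕ<n v))
        ▸ load-step refl (ptrs M v) (≤valBase (<⇒≤ (hdr<valBase v)))
        ▸ load-step refl (rems M v) rem-small
        ▸ here

      scan-entry : (i : Fin (length (nbrs v))) → rem σ v ≡ suc (toℕ i) → val σ v ≢ 3 →
                   Progress σ 22 r₂ m 12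
      scan-entry i rem≡ val≢3 = after read-steps (visit-entry (new? (status σ x)))
        where
        x : Fin n
        x = lookup (nbrs v) i
        entry-small : hdr v + suc (toℕ i) < 2 ^ bits
        entry-small = ≤valBase (<⇒≤ (entry<valBase v (toℕ<n i)))
        r₃ = r₂ [ 18 ≔ hdr v + suc (toℕ i) ] [ 18 ≔ toℕ x ] [ 17 ≔ toℕ i ]
        m₃ = m [ hdr v ≔ toℕ i ]
        read-steps : Steps 5 ⟨ 22 , r₂ , m ⟩ ⟨ 27 , r₃ , m₃ ⟩
        read-steps =
            fall-step refl (λ eq → 1+n≢0 (trans (sym rem≡) (trans eq (r4≡ R))))
          ▸ add-step refl (cong (hdr v +_) rem≡) entry-small
          ▸ load-step refl (adjs M v i) (vertex-small x)
          ▸ sub-step refl (cong₂ _∸_ rem≡ (r1≡ R)) (≤-<-trans (n≤1+n _) (subst (_< 2 ^ bits) rem≡ rem-small))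
          ▸ store-step refl refl refl
          ▸ here
        R₃ : Registers r₃ (scan v (toℕ i) σ)
        R₃ = record { Registers R }
        M₃ : Memory m₃ (scan v (toℕ i) σ)
        M₃ = scan-memory v (toℕ i) M
        lookup≡x : ∀ {k} → toℕ k ≡ toℕ i → lookup (nbrs v) k ≡ x
        lookup≡x k≡i = cong (lookup (nbrs v)) (toℕ-injective k≡i)

        visit-entry : status σ x ≡ new ⊎ status σ x ≢ new → Progress σ 27 r₃ m₃ 7
        visit-entry (inj₂ x≢new) =
          let r′ , S , R′ = visited-steps R₃ M₃ x refl x≢new
          in record
            { time≤ = ≤ᵇ⇒≤ 3 7 tt ; steps = S
            ; inv = scan-inv I v (toℕ i) v-active rem≡ λ k k≡i →
                subst (λ w → status σ w ≢ new × toℕ (root σ w) ≤ toℕ (root σ v)) (sym (lookup≡x k≡i))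
                  (x≢new , s≤s⁻¹ (subst (toℕ (root σ x) <_) (sym (stack-root C v∈stack)) (root<cursor C x x≢new)))
            ; registers = R′ ; memory = M₃ ; decrease = scan-μ σ v rem≡ }
        visit-entry (inj₁ x-new) =
          let r′ , m′ , S , R′ , M′ = visit-steps R₃ M₃ x refl (root σ v) x-new stack<n (tree-length≤ C)
          in record
            { time≤ = ≤-refl ; steps = S
            ; inv = scan-inv I₄ v (toℕ i) (stack⇒active (core I₄) (there v∈stack)) rem≡ λ k k≡i →
                subst (λ w → status σ₄ w ≢ new × toℕ (root σ₄ w) ≤ toℕ (root σ₄ v)) (sym (lookup≡x k≡i))
                  ( active≢new (⟨≔⟩-updates (status σ) x)
                  , ≤-reflexive (cong toℕ (trans (⟨≔⟩-updates (root σ) x) (sym (⟨≔⟩-minimal (root σ) v≢x)))))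
            ; registers = R′ ; memory = M′
            ; decrease = <-trans (scan-μ σ₄ v rem≡) (visit-μ σ x (root σ v) x-new ≤-refl) }
          where
          σ₄ = visit x (root σ v) (cursor σ) σ
          v≢x : v ≢ x
          v≢x v≡x = active≢new v-active (trans (cong (status σ) v≡x) x-new)
          val<3 : val σ v < 3
          val<3 = ≤∧≢⇒< (stack-val C v∈stack) val≢3
          I₄ : Inv σ₄
          I₄ = visit-inv I x (root σ v) (cursor σ) x-new (cursor≤ C) ≤-refl (λ _ → inj₂)
            (stack-root C v∈stack) (stack-root C)
            (subst (λ l → Linked _ (x ∷ l)) (sym stack≡)
              (Equivalence.to (listed v x) (∈-lookup i) ∷ subst (Linked _) stack≡ (stack-path C)))
            (subst (λ l → Bottom (cursor σ) (x ∷ l)) (sym stack≡)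
              (subst (Bottom (cursor σ)) stack≡ (stack-bottom C)))
            (subst (All (λ w → val σ w < 3)) (sym stack≡)
              (val<3 ∷ subst (λ l → All (λ w → val σ w < 3) (drop 1 l)) stack≡ (stack-tail-val C)))
          stack<n : suc (length (stack σ)) ≤ n
          stack<n = Unique⇒length-≤ (stack-unique (core I₄))

      from-top : Progress σ 13 r m 27
      from-top with val σ v Nat.≟ 3
      ... | yes val≡3 = weaken-bound (≤ᵇ⇒≤ 23 27 tt) (after
        (top-steps ▸▸ branch-step refl (trans val≡3 (sym (r3≡ R))) ▸ here)
        (Pop.popped I (record { Registers R }) M v s stack≡ (inj₁ val≡3) refl refl refl refl))
      ... | no val≢3 = by-rem (rem σ v) refl
        where
        by-rem : ∀ k → rem σ v ≡ k → Progress σ 13 r m 27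
        by-rem zero    rem≡ = after
          (top-steps ▸▸ rem-steps val≢3 ▸▸ branch-step refl (trans rem≡ (sym (r4≡ R))) ▸ here)
          (Pop.popped I (record { Registers R }) M v s stack≡ (inj₂ rem≡) refl refl refl refl)
        by-rem (suc j) rem≡ = weaken-bound (≤ᵇ⇒≤ 21 27 tt) (after (top-steps ▸▸ rem-steps val≢3)
          (scan-entry (fromℕ< j<len) (trans rem≡ (cong suc (sym (toℕ-fromℕ< j<len)))) val≢3))
          where
          j<len : j < length (nbrs v)
          j<len = subst (_≤ length (nbrs v)) rem≡ (rem≤ C v)

    iteration : (stack σ ≡ [] × cursor σ ≡ n) ⊎ Progress σ 13 r m 27
    iteration = by-stack (stack σ) refl
      where
      by-stack : ∀ l → stack σ ≡ l → (stack σ ≡ [] × cursor σ ≡ n) ⊎ Progress σ 13 r m 27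
      by-stack (v ∷ s) stack≡ = inj₂ (Top.from-top v s stack≡)
      by-stack []      empty  with m≤n⇒m<n∨m≡n (cursor≤ C)
      ... | inj₁ c<n = inj₂ (weaken-bound (≤ᵇ⇒≤ 12 27 tt) (from-root empty c<n))
      ... | inj₂ c≡n = inj₁ (empty , c≡n)

  record Completed (r m : ℕ → ℕ) (b : ℕ) : Set where
    field
      {time}    : ℕ
      {σ}       : Config
      {r′ m′}   : ℕ → ℕ
      time≤     : time ≤ b
      steps     : Steps time ⟨ 13 , r , m ⟩ ⟨ 13 , r′ , m′ ⟩
      inv       : Inv σ
      registers : Registers r′ σ
      memory    : Memory m′ σ
      stack≡[]  : stack σ ≡ []
      cursor≡n  : cursor σ ≡ n

  complete : ∀ f {σ r m} → μ σ ≤ f → Inv σ → Registers r σ → Memory m σ → Completed r m (f * 27)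
  complete f μ≤f I R M with iteration I R M
  ... | inj₁ (empty , c≡n) = record
    { time≤ = z≤n ; steps = here ; inv = I ; registers = R ; memory = M
    ; stack≡[] = empty ; cursor≡n = c≡n }
  complete zero    μ≤f I R M | inj₂ P = contradiction (≤-trans (Progress.decrease P) μ≤f) λ ()
  complete (suc f) μ≤f I R M | inj₂ P =
    let D = complete f (s≤s⁻¹ (≤-trans (Progress.decrease P) μ≤f))
              (Progress.inv P) (Progress.registers P) (Progress.memory P)
    in record
      { Completed D
      ; time  = Progress.time P + Completed.time D
      ; time≤ = +-mono-≤ (Progress.time≤ P) (Completed.time≤ D)
      ; steps = Progress.steps P ▸▸ Completed.steps D }

last-block : ∀ {n} {G : Graph n} (L : AdjacencyLists G) (U : Subset n) {m} →
  m 0 ≡ n → Layout.Memory L U m (DepthFirst.start L U) →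
  m (m n) + m n + 1 ≡ Layout.valBase L U
last-block {zero}  L U {m} m0≡ _ = cong (_+ 1) (cong₂ _+_ (trans (cong m m0≡) m0≡) m0≡)
last-block {suc n} L U {m} m0≡ M = begin
  m (m (suc n)) + m (suc n) + 1            ≡⟨ cong (λ h → m h + h + 1) last-ptr ⟩
  m (hdr last) + hdr last + 1              ≡⟨ cong (λ l → l + hdr last + 1) (rems M last) ⟩
  length (nbrs last) + hdr last + 1        ≡⟨ rotate (length (nbrs last)) (hdr last) ⟩
  hdr last + suc (length (nbrs last))      ≡⟨ blockStart-last (suc (suc n)) nbrs ⟩
  valBase                                  ∎
  where
  open ≡-Reasoning
  open AdjacencyLists L
  open Layout L U
  open Memory
  last : Fin (suc n)
  last = Fin.fromℕ n
  last-ptr : m (suc n) ≡ hdr last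
  last-ptr = trans (cong (m ∘ suc) (sym (Fin.toℕ-fromℕ n))) (ptrs M last)
  rotate : ∀ a b → a + b + 1 ≡ b + suc a
  rotate = solve-∀

module _ {n : ℕ} {G : Graph n} (L : AdjacencyLists G) (U : Subset n) where
  open AdjacencyLists L
  open DepthFirst L U using (start; module Config)
  open Layout L U

  length-encodeInput : length (encodeInput L U) ≡ markBase
  length-encodeInput = begin
    suc (length (as ++ blocks ls ++ bitVector U))
      ≡⟨ cong suc (length-++ as) ⟩
    suc (length as + length (blocks ls ++ bitVector U))
      ≡⟨ cong (suc (length as) +_) (length-++ (blocks ls)) ⟩
    suc (length as + (length (blocks ls) + length (bitVector U)))
      ≡⟨ cong suc (cong₂ _+_ length-as (cong₂ _+_ (length-blocks nbrs) (length-bitVector U))) ⟩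
    suc (n + (blocksLength nbrs + n))
      ≡⟨ +-assoc (suc n) (blocksLength nbrs) n ⟨
    markBase ∎
    where
    open ≡-Reasoning
    ls = tabulate nbrs
    as = blockAddresses (suc n) ls
    length-as : length as ≡ n
    length-as = trans (length-blockAddresses (suc n) ls) (length-tabulate nbrs)

  start-memory : Memory (contents (encodeInput L U)) start
  start-memory = record
    { ptrs    = stored-blockAddresses 1 (suc n) nbrs (proj₁ split)
    ; rems    = λ v → proj₁ (stored-blocks (suc n) nbrs (proj₁ split′) v)
    ; adjs    = λ v j → trans (cong m₀ (+-suc (hdr v) (toℕ j)))
                  (StoredAt-lookup (nbrs v) (proj₂ (stored-blocks (suc n) nbrs (proj₁ split′) v)) j)
    ; vals    = StoredAt-tabulate⁻ (subst (StoredAt m₀ valBase) (bitVector≡tabulate U)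
                  (subst (λ b → StoredAt m₀ (suc n + b) (bitVector U)) (length-blocks nbrs) (proj₂ split′)))
    ; marks   = λ v → contents-beyond (encodeInput L U)
                  (subst (_≤ markBase + toℕ v) (sym length-encodeInput) (m≤m+n markBase (toℕ v)))
    ; edges   = tt
    ; stacked = tt }
    where
    m₀ = contents (encodeInput L U)
    ls = tabulate nbrs
    as = blockAddresses (suc n) ls
    split : StoredAt m₀ 1 as × StoredAt m₀ (1 + length as) (blocks ls ++ bitVector U)
    split = StoredAt-++⁻ as (proj₂ (contents-stored (encodeInput L U)))
    split′ : StoredAt m₀ (suc n) (blocks ls) × StoredAt m₀ (suc n + length (blocks ls)) (bitVector U)
    split′ = StoredAt-++⁻ (blocks ls) (subst (λ l → StoredAt m₀ (suc l) (blocks ls ++ bitVector U))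
      (trans (length-blockAddresses (suc n) ls) (length-tabulate nbrs)) (proj₂ split))

  limit< : ∀ w → length (encodeInput L U) ≤ 2 ^ w → limit < 2 ^ (3 + w)
  limit< w fits = begin-strict
    markBase + n + 1 + n + n + n                ≡⟨ regroup markBase n ⟩
    markBase + (4 * n + 1)                      <⟨ +-monoʳ-< markBase (≤-trans (m≤n+m _ 2) (≤-reflexive (expand n))) ⟩
    markBase + 4 * suc n                        ≤⟨ +-monoʳ-≤ markBase (*-monoʳ-≤ 4 suc-n≤) ⟩
    markBase + 4 * markBase                     ≤⟨ +-mono-≤ ≤2^w (*-monoʳ-≤ 4 ≤2^w) ⟩
    2 ^ w + 4 * 2 ^ w                           ≤⟨ m≤m+n _ (3 * 2 ^ w) ⟩
    2 ^ w + 4 * 2 ^ w + 3 * 2 ^ w               ≡⟨ eight (2 ^ w) ⟩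
    2 ^ (3 + w)                                 ∎
    where
    open ≤-Reasoning
    ≤2^w : markBase ≤ 2 ^ w
    ≤2^w = subst (_≤ 2 ^ w) length-encodeInput fits
    suc-n≤ : suc n ≤ markBase
    suc-n≤ = ≤-trans n<valBase valBase≤markBase
    regroup : ∀ b k → b + k + 1 + k + k + k ≡ b + (4 * k + 1)
    regroup = solve-∀
    expand : ∀ k → 2 + suc (4 * k + 1) ≡ 4 * suc k
    expand = solve-∀
    eight : ∀ x → x + 4 * x + 3 * x ≡ 2 * (2 * (2 * x))
    eight = solve-∀

  start-μ : Config.μ start ≤ 3 * (Graph.edgeCount G + n)
  start-μ = begin
    n + ∑ (λ v → 2 + length (nbrs v))                      ≡⟨ cong (n +_) (∑-+ (λ _ → 2) (length ∘ nbrs)) ⟩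
    n + (∑ {n} (λ _ → 2) + ∑ (length ∘ nbrs))
      ≤⟨ +-monoʳ-≤ n (+-mono-≤ (≤-reflexive (∑-const n 2)) (∑-degree≤ L)) ⟩
    n + (n * 2 + 2 * e)                                    ≤⟨ m≤m+n _ e ⟩
    n + (n * 2 + 2 * e) + e                                ≡⟨ triple n e ⟩
    3 * (e + n)                                            ∎
    where
    open ≤-Reasoning
    e = Graph.edgeCount G
    triple : ∀ k l → k + (k * 2 + 2 * l) + l ≡ 3 * (l + k)
    triple = solve-∀

module _ {n : ℕ} {G : Graph n} (L : AdjacencyLists G) (U : Subset n) (w : ℕ)
         (fits : length (encodeInput L U) ≤ 2 ^ w) where
  private
    bits = 3 + w

    3<2^bits : 3 < 2 ^ bits
    3<2^bits = ≤-trans (≤ᵇ⇒≤ 4 8 tt) (^-monoʳ-≤ 2 (m≤m+n 3 w))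

  open DepthFirst L U
  open Config
  open Layout L U
  open Execution bits
  open Simulation L U bits (limit< L U w fits) 3<2^bits
  open Registers

  private
    m₀ : ℕ → ℕ
    m₀ = contents (encodeInput L U)

    M₀ : Memory m₀ start
    M₀ = start-memory L U

    last-block≡ : m₀ (m₀ n) + m₀ n + 1 ≡ valBase
    last-block≡ = last-block L U refl M₀

    last-block≤ : m₀ (m₀ n) + m₀ n ≤ valBase
    last-block≤ = subst (m₀ (m₀ n) + m₀ n ≤_) last-block≡ (m≤m+n _ 1)

    initialisation : ∃ λ r → Steps 13 (initial (encodeInput L U)) ⟨ 13 , r , m₀ ⟩ × Registers r start
    initialisation = _ ,
      ( const-step refl one-small
      ▸ const-step refl 3<2^bits
      ▸ load-step refl refl (≤n ≤-refl)
      ▸ load-step refl refl (≤valBase (≤-trans (m≤n+m (m₀ n) (m₀ (m₀ n))) last-block≤))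
      ▸ load-step refl refl (≤valBase (≤-trans (m≤m+n (m₀ (m₀ n)) (m₀ n)) last-block≤))
      ▸ add-step refl refl (≤valBase last-block≤)
      ▸ add-step refl last-block≡ (≤valBase ≤-refl)
      ▸ add-step refl refl (≤markBase ≤-refl)
      ▸ add-step refl refl (≤edgeBase ≤-refl)
      ▸ add-step refl refl (≤stackBase (≤-trans (m≤m+n (edgeBase + 1) n) (m≤m+n _ n)))
      ▸ add-step refl refl (≤stackBase (m≤m+n (edgeBase + 1 + n) n))
      ▸ add-step refl refl (≤stackBase ≤-refl)
      ▸ add-step refl refl (≤stackBase (≤-reflexive (+-identityʳ stackBase)))
      ▸ here) , record
      { r0≡ = refl ; r1≡ = refl ; r2≡ = refl ; r3≡ = refl ; r4≡ = refl ; r5≡ = refl ; r6≡ = refl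
      ; r7≡ = refl ; r8≡ = sym (+-identityʳ (edgeBase + 1)) ; r9≡ = refl ; r10≡ = refl ; r11≡ = refl }

  Correct : Set₁
  Correct = ∃[ X ] Σ (Subgraph G) λ T →
    Computes program 3 w L U (81 * suc ((Graph.edgeCount G + n) * α n)) X T ×
    2 * ∣ X ∣ ≤ ∣ U ∣ ×
    IsForest T ×
    (∀ v → Subgraph.degree T v ≤ 4) ×
    (∀ C → IsComponent (G - X) C →
      ∃[ TC ] IsComponent T TC × U ∩ C ⊆ TC)

  module _ {r : ℕ → ℕ} (S : Steps 13 (initial (encodeInput L U)) ⟨ 13 , r , m₀ ⟩)
           (D : Completed r m₀ (3 * (Graph.edgeCount G + n) * 27)) where
    open Completed D
    open Outcome L U inv stack≡[] cursor≡n

    computes : Computes program 3 w L U (81 * suc ((Graph.edgeCount G + n) * α n)) X T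
    computes = _ , _ , tree σ , time-bound , run , isEdgeList , output-fits , output-stored
      where
      m″ : ℕ → ℕ
      m″ = m′ [ edgeBase ≔ length (tree σ) ]

      output-steps : Steps 3 ⟨ 13 , r′ , m′ ⟩ ⟨ 56 , r′ , m″ ⟩
      output-steps =
          branch-step refl (trans (r10≡ registers) (trans (cong (λ l → stackBase + length l) stack≡[])
            (trans (+-identityʳ stackBase) (sym (r9≡ registers)))))
        ▸ branch-step refl (trans (r11≡ registers) (trans cursor≡n (sym (r5≡ registers))))
        ▸ store-step refl (r7≡ registers) (r2≡ registers)
        ▸ here

      run : Run bits program (13 + (time + 3)) (initial (encodeInput L U)) ⟨ 56 , r′ , m″ ⟩
      run = Steps⇒Run (S ▸▸ steps ▸▸ output-steps) refl

      time-bound : 13 + (time + 3) ≤ 81 * suc ((Graph.edgeCount G + n) * α n)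
      time-bound = begin
        13 + (time + 3)                        ≤⟨ +-monoʳ-≤ 13 (+-monoˡ-≤ 3 time≤) ⟩
        13 + (3 * k * 27 + 3)                  ≤⟨ m≤m+n _ 65 ⟩
        13 + (3 * k * 27 + 3) + 65             ≡⟨ collect k ⟩
        81 * suc k                             ≤⟨ *-monoʳ-≤ 81 (s≤s k≤k*α) ⟩
        81 * suc (k * α n)                     ∎
        where
        open ≤-Reasoning
        k = Graph.edgeCount G + n
        k≤k*α : k ≤ k * α n
        k≤k*α = subst (_≤ k * α n) (*-identityʳ k) (*-monoʳ-≤ k (proj₁ (α-spec n)))
        collect : ∀ x → 13 + (3 * x * 27 + 3) + 65 ≡ 81 * suc x
        collect = solve-∀

      edgeCells : List ℕ
      edgeCells = length (tree σ) ∷ flatten (tree σ)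

      tree≤n : length (tree σ) ≤ n
      tree≤n = tree-length≤ (Inv.core inv)

      output-fits : r′ 0 + length (encodeOutput X ⊤ (tree σ)) ≤ 2 ^ bits
      output-fits = begin
        r′ 0 + length (bitVector X ++ bitVector ⊤ ++ edgeCells)           ≡⟨ cong₂ _+_ (r0≡ registers) lengths ⟩
        valBase + (n + (n + suc (length (flatten (tree σ)))))             ≡⟨ regroup valBase n (length (flatten (tree σ))) ⟩
        edgesEnd (tree σ)                                                 ≤⟨ edgesEnd≤stackBase (tree σ) tree≤n ⟩
        stackBase                                                         ≤⟨ <⇒≤ (≤stackBase ≤-refl) ⟩
        2 ^ bits                                                          ∎
        where
        open ≤-Reasoning
        lengths : length (bitVector X ++ bitVector ⊤ ++ edgeCells) ≡ n + (n + suc (length (flatten (tree σ))))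
        lengths = trans (length-++ (bitVector X)) (cong₂ _+_ (length-bitVector X)
          (trans (length-++ (bitVector {n} ⊤)) (cong (_+ length edgeCells) (length-bitVector {n} ⊤))))
        regroup : ∀ b k l → b + (k + (k + suc l)) ≡ b + k + k + 1 + l
        regroup = solve-∀

      stored-bitVector : ∀ {b} (S : Subset n) → (∀ v → m″ (b + toℕ v) ≡ indicator S v) →
                         StoredAt m″ b (bitVector S)
      stored-bitVector S h = subst (StoredAt m″ _) (sym (bitVector≡tabulate S)) (StoredAt-tabulate⁺ h)

      output-stored : StoredAt m″ (r′ 0) (encodeOutput X ⊤ (tree σ))
      output-stored = subst (λ a → StoredAt m″ a (encodeOutput X ⊤ (tree σ))) (sym (r0≡ registers))
        (StoredAt-++⁺ (bitVector X)
          (stored-bitVector X λ v → trans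
            (keep-array m′ valBase (inj₂ markBase≤edgeBase) (Memory.vals memory) v) (sym (indicator-X v)))
          (subst (λ l → StoredAt m″ (valBase + l) (bitVector {n} ⊤ ++ edgeCells)) (sym (length-bitVector X))
            (StoredAt-++⁺ (bitVector {n} ⊤)
              (stored-bitVector ⊤ λ v → trans
                (keep-array m′ markBase (inj₂ ≤-refl) (Memory.marks memory) v)
                (trans (mark-visited (done≢new (all-done v))) (sym (∈⇒indicator {v = v} ∈⊤))))
              (subst (λ l → StoredAt m″ (markBase + l) edgeCells)
                (sym (length-bitVector {n} ⊤))
                ( ≔-updates m′ edgeBase
                , subst (λ a → StoredAt m″ a (flatten (tree σ))) (+-comm edgeBase 1)
                    (keep-stored m′ (edgeBase + 1) (flatten (tree σ))
                      (inj₁ (≤-reflexive (+-comm 1 edgeBase))) (Memory.edges memory)))))))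

    correct-output : Correct
    correct-output = X , T , computes , 2∣X∣≤∣U∣ , isForest , degree≤4 , spans

  correct : Correct
  correct = let _ , S , R = initialisation in
    correct-output S (complete _ (start-μ L U) start-inv R M₀)

theorem1p1 : ∃[ P ] ∃[ k ] ∃[ c ]
    (∀ {n : ℕ} (G : Graph n) (L : AdjacencyLists G) (U : Subset n) (w : ℕ) →
    length (encodeInput L U) ≤ 2 ^ w →
    ∃[ X ] Σ (Subgraph G) λ T →
    Computes P k w L U (c * suc ((Graph.edgeCount G + n) * α n)) X T ×
    2 * ∣ X ∣ ≤ ∣ U ∣ ×
    IsForest T ×
    (∀ v → Subgraph.degree T v ≤ 4) ×
    (∀ C → IsComponent (G - X) C →
    ∃[ TC ] IsComponent T TC × U ∩ C ⊆ TC))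
theorem1p1 = program , 3 , 81 , λ G L U w fits → correct L U w fits
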